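{- For $\sigma\in S_n(132)$, let $L^{U^2D}_n(\sigma)$ denote the length of the longest subsequence of $\sigma$ that repeats the up/down pattern $UUD$ (so $L^{U^2D}_n(\sigma)$ is either equal to $0$ or to $3k+1$ for some $k\in\mathbb{N}$). Then $$E_n^{\text{av}(132)}L^{U^2D}_n\sim\frac37 n \quad\text{as } n\to\infty.$$
   Context: $S_n$ is the set of permutations $\sigma=\sigma_1\cdots\sigma_n$ of $[n]=\{1,\dots,n\}$. A permutation $\sigma\in S_n$ avoids $\tau\in S_3$ if there are no indices $i_1<i_2<i_3$ such that $\sigma_{i_1}\sigma_{i_2}\sigma_{i_3}$ is in the same relative order as $\tau_1\tau_2\tau_3$; $S_n(\tau)$ is the set of $\sigma\in S_n$ avoiding $\tau$. $P_n^{\text{av}(\tau)}$ is the uniform probability measure on $S_n(\tau)$ and $E_n^{\text{av}(\tau)}$ is the corresponding expectation. To a subsequence $\sigma_{i_1},\dots,\sigma_{i_m}$ ($i_1<\cdots<i_m$, $m\ge 2$) of $\sigma$ associate the up/down sequence $V_1\cdots V_{m-1}$, where $V_j=U$ if $\sigma_{i_{j+1}}>\sigma_{i_j}$ and $V_j=D$ if $\sigma_{i_{j+1}}<\sigma_{i_j}$. For a fixed up/down pattern $W=W_1\cdots W_l$ with $W_j\in\{U,D\}$, a subsequence repeats the pattern $W$ if its up/down sequence is $W$ concatenated with itself $k$ times for some $k\in\mathbb{N}=\{1,2,\dots\}$ (so it has length $kl+1$; incomplete patterns are not counted). The length of the longest subsequence repeating $W$ is the maximum such $kl+1$, and is $0$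 if no such subsequence exists. The notation $x_n\sim y_n$ means $x_n/y_n\to1$ as $n\to\infty$. -}

module Defs where

open import Data.Fin.Base using (Fin; zero; suc; _<_)
import Data.Fin.Properties as Fin
open import Data.Integer.Base using (+_)
open import Data.List.Base
  using (List; []; _∷_; [_]; _++_; map; length; concat; replicate; filter; allFin; cartesianProductWith)
open import Data.List.Extrema.Nat using (max)
open import Data.List.Membership.Propositional using (_∈_)
open import Data.List.Membership.Propositional.Properties
  using (∈-allFin; ∈-cartesianProductWith⁺; ∈-filter⁺; ∈-length)
open import Data.List.NonEmpty.Base using (List⁺; toList) renaming (_∷_ to _∷⁺_)
import Data.List.Properties as List
import Data.List.Relation.Unary.All as ListAll
import Data.List.Relation.Unary.AllPairs as ListPairs
open import Data.List.Relation.Unary.Any using (here)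
import Data.List.Relation.Unary.Unique.Propositional as List
open import Data.List.Relation.Unary.Unique.Propositional.Properties
  using (allFin⁺; cartesianProductWith⁺; filter⁺)
open import Data.Nat.Base as ℕ using (ℕ; zero; suc; NonZero; s≤s; z≤n)
open import Data.Nat.ListAction using (sum)
import Data.Nat.Properties as ℕ
open import Data.Product.Base using (Σ-syntax; ∃-syntax; _×_; _,_)
open import Data.Rational.Base as ℚ using (ℚ; 0ℚ; 1ℚ; _/_; _÷_; _-_; ∣_∣)
open import Data.Vec.Base as Vec using (Vec; []; _∷_; lookup)
import Data.Vec.Properties as Vec
open import Data.Vec.Relation.Unary.AllPairs using (allPairs?)
open import Data.Vec.Relation.Unary.Unique.Propositional using (Unique)
open import Data.Vec.Relation.Unary.Unique.Propositional.Properties using (tabulate⁺)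
open import Function.Base using (id)
open import Function.Bundles using (_⇔_; mk⇔; Equivalence)
open import Relation.Binary.PropositionalEquality using (_≡_; refl; sym; cong; subst; subst₂)
open import Relation.Nullary.Decidable using (Dec; yes; no; map′; _×-dec_; _→-dec_; ¬?)
open import Relation.Nullary.Negation using (¬_)
open import Relation.Unary using (Decidable)

-- One-line notation, with [n] shifted to {0,…,n-1}; the permutations are the words
-- without repetitions.
Word : ℕ → Set
Word n = Vec (Fin n) n

vectors : ∀ {A : Set} → List A → ∀ k → List (Vec A k)
vectors xs zero    = [ [] ]
vectors xs (suc k) = cartesianProductWith _∷_ xs (vectors xs k)

unique? : ∀ {n k} → Decidable (Unique {A = Fin n} {k})
unique? = allPairs? λ x y → ¬? (x Fin.≟ y)

permutations : ∀ n → List (Word n)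
permutations n = filter unique? (vectors (allFin n) n)

∈-vectors : ∀ {n k} (v : Vec (Fin n) k) → v ∈ vectors (allFin n) k
∈-vectors []      = here refl
∈-vectors (x ∷ v) = ∈-cartesianProductWith⁺ _∷_ (∈-allFin x) (∈-vectors v)

∈-permutations : ∀ {n} {σ : Word n} → Unique σ → σ ∈ permutations n
∈-permutations {σ = σ} u = ∈-filter⁺ unique? (∈-vectors σ) u

vectors-unique : ∀ {n} k → List.Unique (vectors (allFin n) k)
vectors-unique     zero    = ListAll.[] ListPairs.∷ ListPairs.[]
vectors-unique {n} (suc k) =
  cartesianProductWith⁺ _∷_ Vec.∷-injective (allFin⁺ n) (vectors-unique k)

permutations-unique : ∀ n → List.Unique (permutations n)
permutations-unique n = filter⁺ unique? (vectors-unique n)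

Occurs : ∀ {n} → Word 3 → Word n → Vec (Fin n) 3 → Set
Occurs τ σ i = ∀ a b → lookup τ a < lookup τ b ⇔ lookup σ (lookup i a) < lookup σ (lookup i b)

Contains : ∀ {n} → Word 3 → Word n → Set
Contains τ σ = ∃[ i₁ ] ∃[ i₂ ] ∃[ i₃ ]
  (i₁ < i₂ × i₂ < i₃ × Occurs τ σ (i₁ ∷ i₂ ∷ i₃ ∷ []))

Avoids : ∀ {n} → Word 3 → Word n → Set
Avoids τ σ = ¬ Contains τ σ

_⇔?_ : ∀ {A B : Set} → Dec A → Dec B → Dec (A ⇔ B)
a? ⇔? b? = map′ (λ (f , g) → mk⇔ f g) (λ e → Equivalence.to e , Equivalence.from e)
             ((a? →-dec b?) ×-dec (b? →-dec a?))

occurs? : ∀ {n} (τ : Word 3) (σ : Word n) → Decidable (Occurs τ σ)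
occurs? τ σ i = Fin.all? λ a → Fin.all? λ b →
  (lookup τ a Fin.<? lookup τ b) ⇔? (lookup σ (lookup i a) Fin.<? lookup σ (lookup i b))

avoids? : ∀ {n} (τ : Word 3) → Decidable (Avoids {n} τ)
avoids? τ σ = ¬? (Fin.any? λ i₁ → Fin.any? λ i₂ → Fin.any? λ i₃ →
  (i₁ Fin.<? i₂) ×-dec (i₂ Fin.<? i₃) ×-dec occurs? τ σ (i₁ ∷ i₂ ∷ i₃ ∷ []))

S⟨_⟩ : Word 3 → ∀ n → List (Word n)
S⟨ τ ⟩ n = filter (avoids? τ) (permutations n)

τ₁₃₂ : Word 3
τ₁₃₂ = zero ∷ suc (suc zero) ∷ suc zero ∷ []

identity-avoids-132 : ∀ n → Avoids τ₁₃₂ (Vec.allFin n)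
identity-avoids-132 n (i₁ , i₂ , i₃ , _ , i₂<i₃ , occ) =
  Fin.<-asym i₂<i₃ (subst₂ _<_ (Vec.lookup-allFin i₃) (Vec.lookup-allFin i₂)
    (Equivalence.to (occ (suc (suc zero)) (suc zero)) (s≤s (s≤s z≤n))))

S⟨132⟩-nonZero : ∀ n → NonZero (length (S⟨ τ₁₃₂ ⟩ n))
S⟨132⟩-nonZero n = ℕ.>-nonZero (∈-length
  (∈-filter⁺ (avoids? τ₁₃₂) (∈-permutations (tabulate⁺ id)) (identity-avoids-132 n)))

data Step : Set where
  U D : Step

_≟ˢ_ : (s t : Step) → Dec (s ≡ t)
U ≟ˢ U = yes refl
U ≟ˢ D = no λ ()
D ≟ˢ U = no λ ()
D ≟ˢ D = yes refl

-- Only applied to lists without repetitions, so ¬ (x < y) means y < x.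
step : ∀ {n} → Fin n → Fin n → Step
step x y with x Fin.<? y
... | yes _ = U
... | no  _ = D

upDown : ∀ {n} → List (Fin n) → List Step
upDown []           = []
upDown (x ∷ [])     = []
upDown (x ∷ y ∷ xs) = step x y ∷ upDown (y ∷ xs)

-- As W is nonempty, so is the right-hand side, which forces length s ≥ 2.
Repeats : ∀ {n} → List⁺ Step → List (Fin n) → Set
Repeats W s = ∃[ k ] (1 ℕ.≤ k × upDown s ≡ concat (replicate k (toList W)))

k≤length : ∀ (W : List⁺ Step) k → k ℕ.≤ length (concat (replicate k (toList W)))
k≤length W           zero    = z≤n
k≤length W@(x ∷⁺ xs) (suc k) = s≤s (subst (k ℕ.≤_)
  (sym (List.length-++ xs))
  (ℕ.≤-trans (k≤length W k) (ℕ.m≤n+m _ (length xs))))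

repeats? : ∀ {n} (W : List⁺ Step) → Decidable (Repeats {n} W)
repeats? W s = map′
  (λ (k , _ , r) → k , r)
  (λ (k , 1≤k , eq) →
    k , s≤s (subst (k ℕ.≤_) (sym (cong length eq)) (k≤length W k)) , 1≤k , eq)
  (ℕ.anyUpTo?
    (λ k → (1 ℕ.≤? k) ×-dec List.≡-dec _≟ˢ_ (upDown s) (concat (replicate k (toList W))))
    (suc (length (upDown s))))

subsequences : ∀ {A : Set} → List A → List (List A)
subsequences []       = [ [] ]
subsequences (x ∷ xs) = map (x ∷_) (subsequences xs) ++ subsequences xs

-- The first argument of max makes the value 0 when no subsequence repeats W.
longest : ∀ {n} → List⁺ Step → Word n → ℕ
longest W σ = max 0 (map length (filter (repeats? W) (subsequences (Vec.toList σ))))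

UUD : List⁺ Step
UUD = U ∷⁺ U ∷ D ∷ []

-- Expectation of X under the uniform measure on a nonempty list without repetitions.
mean : ∀ {A : Set} (xs : List A) .{{_ : NonZero (length xs)}} → (A → ℕ) → ℚ
mean xs X = + sum (map X xs) / length xs

E₁₃₂ : ∀ n → (Word n → ℕ) → ℚ
E₁₃₂ n = mean (S⟨ τ₁₃₂ ⟩ n) {{S⟨132⟩-nonZero n}}

-- x n ÷ y n → 1; the sequence y need only be nonzero eventually.
infix 4 _∼_
_∼_ : (x y : ℕ → ℚ) → Set
x ∼ y = ∀ ε → 0ℚ ℚ.< ε → ∃[ N ] (∀ n → N ℕ.≤ n →
  Σ[ y≢0 ∈ ℚ.NonZero (y n) ] ∣ _÷_ (x n) (y n) {{y≢0}} - 1ℚ ∣ ℚ.< ε)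

-- A 132-avoiding permutation with last letter r is xs ys r with xs > r > ys, so these permutations
-- correspond to binary trees node g h. Reading greedily from the left, UUD is completed once for
-- every node whose right subtree is in state "two" (an unfinished ascent of two letters), so up to
-- a bounded error the longest subsequence has length 3 K, where K is the number of these nodes
-- ("cuts"). The state of a tree depends only on the states of its two subtrees. With y = x C(x),
-- solving the linear equations for the generating functions by state gives
-- y³ / (1 - y + 2y² - y³) for the trees with a cut at the root and, dividing by
-- 1 - 2y = √(1 - 4x), the generating function of the sum of K over all trees. Splitting off
-- (1/7) / (1 - 2y), that is (1/7) (n + 1) Cₙ, leaves bounded combinations of counts of trees, so
-- that the mean of K is n/7 + O(1).
module Submission where

open import Defs
open import Data.Fin.Base as Fin using (Fin; toℕ; fromℕ<)
import Data.Fin.Properties as Fin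
import Data.Integer.Base as ℤ
import Data.Integer.Properties as ℤ
open import Data.List.Base
  using (List; []; _∷_; _++_; map; length; take; concat; replicate; filter; initLast; _∷ʳ′_; cartesianProductWith)
open import Data.List.Extrema.Nat using (max≤v⁺; xs≤max)
open import Data.List.Membership.Propositional using (_∈_)
open import Data.List.Membership.Propositional.Properties
  using (∈-cartesianProductWith⁺; ∈-cartesianProductWith⁻; ∈-++⁺ˡ; ∈-++⁺ʳ; ∈-++⁻; ∈-map⁺; ∈-map⁻; ∈-filter⁺; ∈-filter⁻)
open import Data.List.Membership.Propositional.Properties.WithK using (unique∧set⇒bag)
open import Data.List.Properties
  using (map-++; map-∘; map-cong; length-++; length-take; length-map; ++-assoc; ++-identityʳ;
         ∷-injective; ∷-injectiveˡ; ∷-injectiveʳ; ∷ʳ-injective)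
open import Data.List.Relation.Binary.BagAndSetEquality using (∼bag⇒↭)
open import Data.List.Relation.Binary.Disjoint.Propositional using (Disjoint)
open import Data.List.Relation.Binary.Permutation.Propositional using (_↭_)
open import Data.List.Relation.Binary.Permutation.Propositional.Properties
  using (↭-map-inv; ↭-length) renaming (map⁺ to ↭-map⁺)
open import Data.List.Relation.Binary.Sublist.Propositional
  using (_⊆_; []; _∷_; _∷ʳ_; ⊆-refl; ⊆-trans; minimum)
open import Data.List.Relation.Binary.Sublist.Propositional.Properties
  using (All-resp-⊆; take-⊆; ++⁺; ++⁺ʳ; ++⁺ˡ) renaming (map⁺ to ⊆-map⁺)
open import Data.List.Relation.Unary.All as All using (All; []; _∷_)
import Data.List.Relation.Unary.All.Properties as All
open import Data.List.Relation.Unary.AllPairs using (AllPairs; []; _∷_)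
import Data.List.Relation.Unary.AllPairs.Properties as AllPairs
open import Data.List.Relation.Unary.Any using (here; there)
open import Data.List.Relation.Unary.Unique.Propositional using (Unique)
import Data.List.Relation.Unary.Unique.Propositional.Properties as Unique
open import Data.Nat.Base as ℕ hiding (_/_)
open import Data.Nat.DivMod using (m≡m%n+[m/n]*n; m%n<n)
open import Data.Nat.ListAction using (sum)
open import Data.Nat.ListAction.Properties using (sum-++; sum-↭)
open import Data.Nat.Properties
open import Data.Nat.Tactic.RingSolver using (solve-∀)
open import Data.Product.Base using (∃-syntax; _×_; _,_; proj₁; proj₂)
open import Data.Rational.Base as ℚ using (ℚ; mkℚ; 1ℚ; _/_; toℚᵘ)
import Data.Rational.Properties as ℚ
open import Data.Rational.Unnormalised.Base as ℚᵘ using (mkℚᵘ; *≤*; *<*)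
import Data.Rational.Unnormalised.Properties as ℚᵘ
open import Data.Sum.Base using (inj₁; inj₂)
open import Data.Unit.Base using (⊤; tt)
open import Data.Vec.Base using (Vec; []; _∷_; lookup; toList)
import Data.Vec.Relation.Unary.All.Properties as VecAll
import Data.Vec.Relation.Unary.AllPairs as VecPairs
import Data.Vec.Relation.Unary.Unique.Propositional as Vec
open import Function.Base using (_∘_)
open import Function.Bundles using (Equivalence; mk⇔)
open import Relation.Binary.Definitions using (tri<; tri≈; tri>)
open import Relation.Binary.PropositionalEquality
open import Relation.Nullary.Decidable using (yes; no)
open import Relation.Nullary.Negation using (¬_; contradiction)

-- Binary trees

-- The constant 1/7 is the value of A = y³ / (1 - y + 2y² - y³) at y = 1/2, that is at x = 1/4, the
-- dominant singularity, where 1 - 2y vanishes. So 1 - 7A has the factor 1 - 2y, and the quotient (1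
-- + y + 4y²) / (1 - y + 2y² - y³) equals 1 + 2P₁ + 4P₂ - A, where P₁ and P₂ count the trees in
-- states `one` and `two`. This is the origin of the coefficients in `cuts-identity`. Read
-- coefficientwise with all terms positive, it is an identity of natural numbers that is proved by
-- induction through convolution with the Catalan numbers. It bounds the mean without any estimate
-- of those numbers, because each leftover term counts a subset of the trees. On the combinatorial
-- side the obstacle is that a repetition of UUD must be complete, a condition that does not
-- decompose along a tree. The subsequences measured are therefore those following any prefix of
-- UUDUUD...; their maximal length is exactly 3 K plus a term read off the state, and truncation to
-- 3k + 1 letters costs at most three.

data Tree : Set where
  leaf : Tree
  node : (g h : Tree) → Tree

size : Tree → ℕ
size leaf       = 0
size (node g h) = suc (size g + size h)

-- List counterpart of `conv`: the splittings of `n` are run through by shifting `F`, so the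
-- recursion is structural and no subtraction occurs.
graft : (F G : ℕ → List Tree) → ℕ → List Tree
graft F G zero    = cartesianProductWith node (F 0) (G 0)
graft F G (suc n) = cartesianProductWith node (F 0) (G (suc n)) ++ graft (F ∘ suc) G n

graft-cong : ∀ {F F′ G G′} n → (∀ i → i ≤ n → F i ≡ F′ i) → (∀ i → i ≤ n → G i ≡ G′ i) →
             graft F G n ≡ graft F′ G′ n
graft-cong zero    p q = cong₂ (cartesianProductWith node) (p 0 z≤n) (q 0 z≤n)
graft-cong (suc n) p q = cong₂ _++_
  (cong₂ (cartesianProductWith node) (p 0 z≤n) (q (suc n) ≤-refl))
  (graft-cong n (λ i i≤n → p (suc i) (s≤s i≤n)) (λ i i≤n → q i (m≤n⇒m≤1+n i≤n)))

-- The first argument is fuel; it only has to be at least the size.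
treesWithin : ℕ → ℕ → List Tree
treesWithin _       zero    = leaf ∷ []
treesWithin zero    (suc n) = []
treesWithin (suc k) (suc n) = graft (treesWithin k) (treesWithin k) n

trees : ℕ → List Tree
trees n = treesWithin n n

treesWithin-irrelevant : ∀ {k l} n → n ≤ k → n ≤ l → treesWithin k n ≡ treesWithin l n
treesWithin-irrelevant zero    _         _         = refl
treesWithin-irrelevant (suc n) (s≤s n≤k) (s≤s n≤l) = graft-cong n same same
  where
  same : ∀ i → i ≤ n → treesWithin _ i ≡ treesWithin _ i
  same i i≤n = treesWithin-irrelevant i (≤-trans i≤n n≤k) (≤-trans i≤n n≤l)

trees-suc : ∀ n → trees (suc n) ≡ graft trees trees n
trees-suc n = graft-cong n same same
  where
  same : ∀ i → i ≤ n → treesWithin n i ≡ trees i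
  same i i≤n = treesWithin-irrelevant i i≤n ≤-refl

∈-graft⁻ : ∀ F G n {t} → t ∈ graft F G n →
           ∃[ i ] ∃[ j ] ∃[ g ] ∃[ h ] (i + j ≡ n × g ∈ F i × h ∈ G j × t ≡ node g h)
∈-graft⁻ F G zero t∈ with ∈-cartesianProductWith⁻ node (F 0) (G 0) t∈
... | g , h , g∈ , h∈ , eq = 0 , 0 , g , h , refl , g∈ , h∈ , eq
∈-graft⁻ F G (suc n) t∈ with ∈-++⁻ (cartesianProductWith node (F 0) (G (suc n))) t∈
... | inj₁ t∈ˡ with ∈-cartesianProductWith⁻ node (F 0) (G (suc n)) t∈ˡ
...   | g , h , g∈ , h∈ , eq = 0 , suc n , g , h , refl , g∈ , h∈ , eq
∈-graft⁻ F G (suc n) t∈ | inj₂ t∈ʳ with ∈-graft⁻ (F ∘ suc) G n t∈ʳ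
...   | i , j , g , h , i+j≡n , g∈ , h∈ , eq = suc i , j , g , h , cong suc i+j≡n , g∈ , h∈ , eq

∈-graft⁺ : ∀ F G i j {g h} → g ∈ F i → h ∈ G j → node g h ∈ graft F G (i + j)
∈-graft⁺ F G zero    zero    g∈ h∈ = ∈-cartesianProductWith⁺ node g∈ h∈
∈-graft⁺ F G zero    (suc j) g∈ h∈ = ∈-++⁺ˡ (∈-cartesianProductWith⁺ node g∈ h∈)
∈-graft⁺ F G (suc i) j       g∈ h∈ = ∈-++⁺ʳ _ (∈-graft⁺ (F ∘ suc) G i j g∈ h∈)

node-injective : ∀ {g g′ h h′} → node g h ≡ node g′ h′ → g ≡ g′ × h ≡ h′
node-injective refl = refl , refl

-- The blocks of the concatenation differ in the size of the left subtree. The offset `o` records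
-- how often `F` has been shifted, as the induction replaces `F` by `F ∘ suc`.
graft-unique : ∀ F G n o → (∀ i {t} → t ∈ F i → size t ≡ i + o) →
               (∀ i → Unique (F i)) → (∀ i → Unique (G i)) → Unique (graft F G n)
graft-unique F G zero    o sz uF uG = Unique.cartesianProductWith⁺ node node-injective (uF 0) (uG 0)
graft-unique F G (suc n) o sz uF uG = Unique.++⁺
  (Unique.cartesianProductWith⁺ node node-injective (uF 0) (uG (suc n)))
  (graft-unique (F ∘ suc) G n (suc o) (λ i t∈ → trans (sz (suc i) t∈) (sym (+-suc i o))) (uF ∘ suc) uG)
  disjoint
  where
  disjoint : Disjoint (cartesianProductWith node (F 0) (G (suc n))) (graft (F ∘ suc) G n)
  disjoint (t∈ˡ , t∈ʳ)
    with ∈-cartesianProductWith⁻ node (F 0) (G (suc n)) t∈ˡ | ∈-graft⁻ (F ∘ suc) G n t∈ʳ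
  ... | g , h , g∈ , _ , refl | i , _ , _ , _ , _ , g∈′ , _ , refl =
    m≢1+n+m o (trans (sym (sz 0 g∈)) (sz (suc i) g∈′))

size-∈-treesWithin : ∀ k n {t} → t ∈ treesWithin k n → size t ≡ n
size-∈-treesWithin zero    zero    (here refl) = refl
size-∈-treesWithin (suc k) zero    (here refl) = refl
size-∈-treesWithin (suc k) (suc n) t∈ with ∈-graft⁻ (treesWithin k) (treesWithin k) n t∈
... | i , j , g , h , i+j≡n , g∈ , h∈ , refl = cong suc
  (trans (cong₂ _+_ (size-∈-treesWithin k i g∈) (size-∈-treesWithin k j h∈)) i+j≡n)

size-∈-trees : ∀ {n t} → t ∈ trees n → size t ≡ n
size-∈-trees {n} = size-∈-treesWithin n n

treesWithin-unique : ∀ k n → Unique (treesWithin k n)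
treesWithin-unique zero    zero    = [] ∷ []
treesWithin-unique (suc k) zero    = [] ∷ []
treesWithin-unique zero    (suc n) = []
treesWithin-unique (suc k) (suc n) = graft-unique (treesWithin k) (treesWithin k) n 0
  (λ i t∈ → trans (size-∈-treesWithin k i t∈) (sym (+-identityʳ i)))
  (treesWithin-unique k) (treesWithin-unique k)

trees-unique : ∀ n → Unique (trees n)
trees-unique n = treesWithin-unique n n

∈-trees : ∀ t → t ∈ trees (size t)
∈-trees leaf       = here refl
∈-trees (node g h) = subst (node g h ∈_) (sym (trees-suc (size g + size h)))
  (∈-graft⁺ trees trees (size g) (size h) (∈-trees g) (∈-trees h))

-- Convolution of sequences

conv : (f g : ℕ → ℕ) → ℕ → ℕ
conv f g zero    = f 0 * g 0
conv f g (suc n) = f 0 * g (suc n) + conv (f ∘ suc) g n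

conv-cong : ∀ {f f′ g g′} n → (∀ i → i ≤ n → f i ≡ f′ i) → (∀ i → i ≤ n → g i ≡ g′ i) →
            conv f g n ≡ conv f′ g′ n
conv-cong zero    p q = cong₂ _*_ (p 0 z≤n) (q 0 z≤n)
conv-cong (suc n) p q = cong₂ _+_
  (cong₂ _*_ (p 0 z≤n) (q (suc n) ≤-refl))
  (conv-cong n (λ i i≤n → p (suc i) (s≤s i≤n)) (λ i i≤n → q i (m≤n⇒m≤1+n i≤n)))

conv-+ˡ : ∀ f g h n → conv (λ i → f i + g i) h n ≡ conv f h n + conv g h n
conv-+ˡ f g h zero    = *-distribʳ-+ (h 0) (f 0) (g 0)
conv-+ˡ f g h (suc n) = trans
  (cong ((f 0 + g 0) * h (suc n) +_) (conv-+ˡ (f ∘ suc) (g ∘ suc) h n))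
  (arith (f 0) (g 0) (h (suc n)) (conv (f ∘ suc) h n) (conv (g ∘ suc) h n))
  where
  arith : ∀ a b c u v → (a + b) * c + (u + v) ≡ (a * c + u) + (b * c + v)
  arith = solve-∀

conv-*ˡ : ∀ c f g n → conv (λ i → c * f i) g n ≡ c * conv f g n
conv-*ˡ c f g zero    = *-assoc c (f 0) (g 0)
conv-*ˡ c f g (suc n) = trans
  (cong (c * f 0 * g (suc n) +_) (conv-*ˡ c (f ∘ suc) g n))
  (arith c (f 0) (g (suc n)) (conv (f ∘ suc) g n))
  where
  arith : ∀ c a b u → c * a * b + c * u ≡ c * (a * b + u)
  arith = solve-∀

conv-sucʳ : ∀ f g n → conv f g (suc n) ≡ conv f (g ∘ suc) n + f (suc n) * g 0
conv-sucʳ f g zero    = refl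
conv-sucʳ f g (suc n) = trans
  (cong (f 0 * g (2 + n) +_) (conv-sucʳ (f ∘ suc) g n))
  (sym (+-assoc (f 0 * g (2 + n)) _ _))

conv-comm : ∀ f g n → conv f g n ≡ conv g f n
conv-comm f g zero    = *-comm (f 0) (g 0)
conv-comm f g (suc n) = begin
  f 0 * g (suc n) + conv (f ∘ suc) g n  ≡⟨ cong₂ _+_ (*-comm (f 0) (g (suc n))) (conv-comm (f ∘ suc) g n) ⟩
  g (suc n) * f 0 + conv g (f ∘ suc) n  ≡⟨ +-comm (g (suc n) * f 0) _ ⟩
  conv g (f ∘ suc) n + g (suc n) * f 0  ≡⟨ conv-sucʳ g f n ⟨
  conv g f (suc n)                      ∎
  where open ≡-Reasoning

conv-assoc : ∀ f g h n → conv (conv f g) h n ≡ conv f (conv g h) n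
conv-assoc f g h zero    = *-assoc (f 0) (g 0) (h 0)
conv-assoc f g h (suc n) = begin
  f 0 * g 0 * h (suc n) + conv (λ i → f 0 * g (suc i) + conv (f ∘ suc) g i) h n
    ≡⟨ cong (f 0 * g 0 * h (suc n) +_) (conv-+ˡ (λ i → f 0 * g (suc i)) (conv (f ∘ suc) g) h n) ⟩
  f 0 * g 0 * h (suc n) + (conv (λ i → f 0 * g (suc i)) h n + conv (conv (f ∘ suc) g) h n)
    ≡⟨ cong (f 0 * g 0 * h (suc n) +_)
         (cong₂ _+_ (conv-*ˡ (f 0) (g ∘ suc) h n) (conv-assoc (f ∘ suc) g h n)) ⟩
  f 0 * g 0 * h (suc n) + (f 0 * conv (g ∘ suc) h n + conv (f ∘ suc) (conv g h) n)
    ≡⟨ arith (f 0) (g 0) (h (suc n)) _ _ ⟩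
  f 0 * (g 0 * h (suc n) + conv (g ∘ suc) h n) + conv (f ∘ suc) (conv g h) n
    ∎
  where
  open ≡-Reasoning
  arith : ∀ a b c u v → a * b * c + (a * u + v) ≡ a * (b * c + u) + v
  arith = solve-∀

-- Sums of weights over the trees of a given size

total : (Tree → ℕ) → ℕ → ℕ
total φ n = sum (map φ (trees n))

sum-map-+ : ∀ {A : Set} (φ ψ : A → ℕ) xs →
            sum (map (λ x → φ x + ψ x) xs) ≡ sum (map φ xs) + sum (map ψ xs)
sum-map-+ φ ψ []       = refl
sum-map-+ φ ψ (x ∷ xs) = trans (cong (φ x + ψ x +_) (sum-map-+ φ ψ xs))
  (arith (φ x) (ψ x) (sum (map φ xs)) (sum (map ψ xs)))
  where
  arith : ∀ a b c d → (a + b) + (c + d) ≡ (a + c) + (b + d)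
  arith = solve-∀

sum-map-* : ∀ {A : Set} c (φ : A → ℕ) xs → sum (map (λ x → c * φ x) xs) ≡ c * sum (map φ xs)
sum-map-* c φ []       = sym (*-zeroʳ c)
sum-map-* c φ (x ∷ xs) = trans (cong (c * φ x +_) (sum-map-* c φ xs))
  (sym (*-distribˡ-+ c (φ x) _))

sum-map-≤ : ∀ {A : Set} {φ ψ : A → ℕ} → (∀ x → φ x ≤ ψ x) → ∀ xs → sum (map φ xs) ≤ sum (map ψ xs)
sum-map-≤ p []       = z≤n
sum-map-≤ p (x ∷ xs) = +-mono-≤ (p x) (sum-map-≤ p xs)

total-+ : ∀ φ ψ n → total (λ t → φ t + ψ t) n ≡ total φ n + total ψ n
total-+ φ ψ n = sum-map-+ φ ψ (trees n)

total-cong : ∀ {φ ψ} → (∀ t → φ t ≡ ψ t) → ∀ n → total φ n ≡ total ψ n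
total-cong p n = cong sum (map-cong p (trees n))

total-≤ : ∀ {φ ψ} → (∀ t → φ t ≤ ψ t) → ∀ n → total φ n ≤ total ψ n
total-≤ p n = sum-map-≤ p (trees n)

infixl 7 _⊗_
_⊗_ : (φ ψ : Tree → ℕ) → Tree → ℕ
(φ ⊗ ψ) leaf       = 0
(φ ⊗ ψ) (node g h) = φ g * ψ h

sum-map-cartesianProduct : ∀ φ ψ xs ys →
  sum (map (φ ⊗ ψ) (cartesianProductWith node xs ys)) ≡ sum (map φ xs) * sum (map ψ ys)
sum-map-cartesianProduct φ ψ []       ys = refl
sum-map-cartesianProduct φ ψ (x ∷ xs) ys = begin
  sum (map (φ ⊗ ψ) (map (node x) ys ++ rest))
    ≡⟨ cong sum (map-++ (φ ⊗ ψ) (map (node x) ys) rest) ⟩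
  sum (map (φ ⊗ ψ) (map (node x) ys) ++ map (φ ⊗ ψ) rest)
    ≡⟨ sum-++ (map (φ ⊗ ψ) (map (node x) ys)) _ ⟩
  sum (map (φ ⊗ ψ) (map (node x) ys)) + sum (map (φ ⊗ ψ) rest)
    ≡⟨ cong₂ _+_ (trans (cong sum (sym (map-∘ ys))) (sum-map-* (φ x) ψ ys))
                 (sum-map-cartesianProduct φ ψ xs ys) ⟩
  φ x * sum (map ψ ys) + sum (map φ xs) * sum (map ψ ys)
    ≡⟨ *-distribʳ-+ (sum (map ψ ys)) (φ x) _ ⟨
  (φ x + sum (map φ xs)) * sum (map ψ ys)
    ∎
  where
  open ≡-Reasoning
  rest : List Tree
  rest = cartesianProductWith node xs ys

sum-map-graft : ∀ φ ψ F G n →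
  sum (map (φ ⊗ ψ) (graft F G n)) ≡ conv (λ i → sum (map φ (F i))) (λ i → sum (map ψ (G i))) n
sum-map-graft φ ψ F G zero    = sum-map-cartesianProduct φ ψ (F 0) (G 0)
sum-map-graft φ ψ F G (suc n) = begin
  sum (map (φ ⊗ ψ) (top ++ graft (F ∘ suc) G n))
    ≡⟨ cong sum (map-++ (φ ⊗ ψ) top _) ⟩
  sum (map (φ ⊗ ψ) top ++ map (φ ⊗ ψ) (graft (F ∘ suc) G n))
    ≡⟨ sum-++ (map (φ ⊗ ψ) top) _ ⟩
  sum (map (φ ⊗ ψ) top) + sum (map (φ ⊗ ψ) (graft (F ∘ suc) G n))
    ≡⟨ cong₂ _+_ (sum-map-cartesianProduct φ ψ (F 0) (G (suc n))) (sum-map-graft φ ψ (F ∘ suc) G n) ⟩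
  conv (λ i → sum (map φ (F i))) (λ i → sum (map ψ (G i))) (suc n)
    ∎
  where
  open ≡-Reasoning
  top : List Tree
  top = cartesianProductWith node (F 0) (G (suc n))

-- The passage from trees to generating functions: a weight that factors over the two subtrees of a
-- node contributes x times the product of the two generating functions.
total-⊗ : ∀ φ ψ n → total (φ ⊗ ψ) (suc n) ≡ conv (total φ) (total ψ) n
total-⊗ φ ψ n = trans (cong (sum ∘ map (φ ⊗ ψ)) (trees-suc n)) (sum-map-graft φ ψ trees trees n)

total-zero : ∀ φ n → (∀ t → size t ≡ n → φ t ≡ 0) → total φ n ≡ 0
total-zero φ n p = sum-map-zero (trees n) (λ t∈ → p _ (size-∈-trees t∈))
  where
  sum-map-zero : ∀ ts → (∀ {t} → t ∈ ts → φ t ≡ 0) → sum (map φ ts) ≡ 0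
  sum-map-zero []       q = refl
  sum-map-zero (t ∷ ts) q = cong₂ _+_ (q (here refl)) (sum-map-zero ts (q ∘ there))

-- The greedy statistic on trees

-- What the greedy reading of a word has left since the last cut: one or two letters of an
-- unfinished UUD, or nothing. In the state spent the word is not empty, and a letter exceeding all
-- others cannot start a new UUD after it; this separates it from the state none of the empty word.
data State : Set where
  none spent one two : State

-- Effect of a last letter below the whole preceding word. It can start a new UUD by descending from
-- the last completed one; against one unfinished letter it gains nothing, and two unfinished
-- letters are better kept.
bump : State → State
bump two = two
bump _   = one

-- The left word lies above everything after it, so crossing over is a descent, and unfinished
-- letters on the left are lost. The rest is decided by the right word followed by a letter above
-- it. Only an empty right word leaves a choice, which `bump` makes.
join : State → State → State
join s none  = bump s
join _ one   = two
join _ two   = spent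
join _ spent = spent

state : Tree → State
state leaf       = none
state (node g h) = join (state g) (state h)

none? one? two? : State → ℕ
none? none = 1
none? _    = 0
one? one = 1
one? _   = 0
two? two = 1
two? _   = 0

𝟙 isLeaf isOne isTwo leaves cuts : Tree → ℕ
𝟙 _ = 1
isLeaf leaf       = 1
isLeaf (node _ _) = 0
isOne = one? ∘ state
isTwo = two? ∘ state
leaves leaf       = 1
leaves (node g h) = leaves g + leaves h
cuts leaf       = 0
cuts (node g h) = cuts g + cuts h + isTwo h

leaves≡1+size : ∀ t → leaves t ≡ suc (size t)
leaves≡1+size leaf       = refl
leaves≡1+size (node g h) = trans (cong₂ _+_ (leaves≡1+size g) (leaves≡1+size h))
  (cong suc (+-suc (size g) (size h)))

-- The additive form replaces a difference of indicators: an empty right word leads to `one` except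
-- when the left state is `two`.
one?-join : ∀ s t → one? (join s t) + two? s * none? t ≡ none? t
one?-join s     one   = *-zeroʳ (two? s)
one?-join s     two   = *-zeroʳ (two? s)
one?-join s     spent = *-zeroʳ (two? s)
one?-join none  none  = refl
one?-join spent none  = refl
one?-join one   none  = refl
one?-join two   none  = refl

two?-join : ∀ s t → two? (join s t) ≡ two? s * none? t + one? t
two?-join s     one   = cong (_+ 1) (sym (*-zeroʳ (two? s)))
two?-join s     two   = cong (_+ 0) (sym (*-zeroʳ (two? s)))
two?-join s     spent = cong (_+ 0) (sym (*-zeroʳ (two? s)))
two?-join none  none  = refl
two?-join spent none  = refl
two?-join one   none  = refl
two?-join two   none  = refl

none?-join : ∀ s t → none? (join s t) ≡ 0
none?-join s     one   = refl
none?-join s     two   = refl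
none?-join s     spent = refl
none?-join none  none  = refl
none?-join spent none  = refl
none?-join one   none  = refl
none?-join two   none  = refl

none?-state : ∀ t → none? (state t) ≡ isLeaf t
none?-state leaf       = refl
none?-state (node g h) = none?-join (state g) (state h)

𝟙-split : ∀ t → 𝟙 t ≡ isLeaf t + (𝟙 ⊗ 𝟙) t
𝟙-split leaf       = refl
𝟙-split (node g h) = refl

leaves-split : ∀ t → leaves t ≡ isLeaf t + ((leaves ⊗ 𝟙) t + (𝟙 ⊗ leaves) t)
leaves-split leaf       = refl
leaves-split (node g h) = sym (cong₂ _+_ (*-identityʳ (leaves g)) (+-identityʳ (leaves h)))

cuts-split : ∀ t → cuts t ≡ ((cuts ⊗ 𝟙) t + (𝟙 ⊗ cuts) t) + (𝟙 ⊗ isTwo) t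
cuts-split leaf       = refl
cuts-split (node g h) = sym (cong₂ _+_
  (cong₂ _+_ (*-identityʳ (cuts g)) (+-identityʳ (cuts h))) (+-identityʳ (isTwo h)))

isTwo-split : ∀ t → isTwo t ≡ (isTwo ⊗ isLeaf) t + (𝟙 ⊗ isOne) t
isTwo-split leaf       = refl
isTwo-split (node g h) = trans (two?-join (state g) (state h))
  (cong₂ (λ a b → isTwo g * a + b) (none?-state h) (sym (+-identityʳ (isOne h))))

isOne-split : ∀ t → isOne t + (isTwo ⊗ isLeaf) t ≡ (𝟙 ⊗ isLeaf) t
isOne-split leaf       = refl
isOne-split (node g h) = begin
  isOne (node g h) + isTwo g * isLeaf h        ≡⟨ cong (λ a → isOne (node g h) + isTwo g * a) (none?-state h) ⟨
  isOne (node g h) + isTwo g * none? (state h) ≡⟨ one?-join (state g) (state h) ⟩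
  none? (state h)                              ≡⟨ none?-state h ⟩
  isLeaf h                                     ≡⟨ +-identityʳ (isLeaf h) ⟨
  1 * isLeaf h                                 ∎
  where open ≡-Reasoning

-- Recurrences by state and the linear identity between them

private
  C Z K p₁ p₂ a δ : ℕ → ℕ
  C  = total 𝟙
  Z  = total leaves
  K  = total cuts
  p₁ = total isOne
  p₂ = total isTwo
  a  = total (𝟙 ⊗ isTwo)
  δ  = total isLeaf

δ-suc : ∀ n → δ (suc n) ≡ 0
δ-suc n = total-zero isLeaf (suc n) λ { (node g h) _ → refl }

conv-zeroʳ : ∀ f g n → (∀ i → i ≤ n → g i ≡ 0) → conv f g n ≡ 0
conv-zeroʳ f g zero    p = trans (cong (f 0 *_) (p 0 z≤n)) (*-zeroʳ (f 0))
conv-zeroʳ f g (suc n) p = cong₂ _+_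
  (trans (cong (f 0 *_) (p (suc n) ≤-refl)) (*-zeroʳ (f 0)))
  (conv-zeroʳ (f ∘ suc) g n (λ i i≤n → p i (m≤n⇒m≤1+n i≤n)))

conv-δ : ∀ f n → conv f δ n ≡ f n
conv-δ f zero    = *-identityʳ (f 0)
conv-δ f (suc n) = begin
  conv f δ (suc n)                      ≡⟨ conv-sucʳ f δ n ⟩
  conv f (δ ∘ suc) n + f (suc n) * 1
    ≡⟨ cong₂ _+_ (conv-zeroʳ f (δ ∘ suc) n (λ i _ → δ-suc i)) (*-identityʳ (f (suc n))) ⟩
  f (suc n)                             ∎
  where open ≡-Reasoning

C-suc : ∀ n → C (suc n) ≡ conv C C n
C-suc n = begin
  C (suc n)                              ≡⟨ total-cong 𝟙-split (suc n) ⟩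
  total (λ t → isLeaf t + (𝟙 ⊗ 𝟙) t) (suc n) ≡⟨ total-+ isLeaf (𝟙 ⊗ 𝟙) (suc n) ⟩
  δ (suc n) + total (𝟙 ⊗ 𝟙) (suc n)      ≡⟨ cong₂ _+_ (δ-suc n) (total-⊗ 𝟙 𝟙 n) ⟩
  conv C C n                             ∎
  where open ≡-Reasoning

Z-suc : ∀ n → Z (suc n) ≡ 2 * conv C Z n
Z-suc n = begin
  Z (suc n)
    ≡⟨ total-cong leaves-split (suc n) ⟩
  total (λ t → isLeaf t + ((leaves ⊗ 𝟙) t + (𝟙 ⊗ leaves) t)) (suc n)
    ≡⟨ total-+ isLeaf _ (suc n) ⟩
  δ (suc n) + total (λ t → (leaves ⊗ 𝟙) t + (𝟙 ⊗ leaves) t) (suc n)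
    ≡⟨ cong₂ _+_ (δ-suc n) (total-+ (leaves ⊗ 𝟙) (𝟙 ⊗ leaves) (suc n)) ⟩
  total (leaves ⊗ 𝟙) (suc n) + total (𝟙 ⊗ leaves) (suc n)
    ≡⟨ cong₂ _+_ (trans (total-⊗ leaves 𝟙 n) (conv-comm Z C n)) (trans (total-⊗ 𝟙 leaves n) (sym (+-identityʳ _))) ⟩
  2 * conv C Z n
    ∎
  where open ≡-Reasoning

K-suc : ∀ n → K (suc n) ≡ 2 * conv C K n + a (suc n)
K-suc n = begin
  K (suc n)
    ≡⟨ total-cong cuts-split (suc n) ⟩
  total (λ t → (cuts ⊗ 𝟙) t + (𝟙 ⊗ cuts) t + (𝟙 ⊗ isTwo) t) (suc n)
    ≡⟨ total-+ (λ t → (cuts ⊗ 𝟙) t + (𝟙 ⊗ cuts) t) (𝟙 ⊗ isTwo) (suc n) ⟩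
  total (λ t → (cuts ⊗ 𝟙) t + (𝟙 ⊗ cuts) t) (suc n) + a (suc n)
    ≡⟨ cong (_+ a (suc n)) (total-+ (cuts ⊗ 𝟙) (𝟙 ⊗ cuts) (suc n)) ⟩
  total (cuts ⊗ 𝟙) (suc n) + total (𝟙 ⊗ cuts) (suc n) + a (suc n)
    ≡⟨ cong (_+ a (suc n)) (cong₂ _+_
         (trans (total-⊗ cuts 𝟙 n) (conv-comm K C n)) (trans (total-⊗ 𝟙 cuts n) (sym (+-identityʳ _)))) ⟩
  2 * conv C K n + a (suc n)
    ∎
  where open ≡-Reasoning

p₂-suc : ∀ n → p₂ (suc n) ≡ p₂ n + conv C p₁ n
p₂-suc n = begin
  p₂ (suc n)
    ≡⟨ total-cong isTwo-split (suc n) ⟩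
  total (λ t → (isTwo ⊗ isLeaf) t + (𝟙 ⊗ isOne) t) (suc n)
    ≡⟨ total-+ (isTwo ⊗ isLeaf) (𝟙 ⊗ isOne) (suc n) ⟩
  total (isTwo ⊗ isLeaf) (suc n) + total (𝟙 ⊗ isOne) (suc n)
    ≡⟨ cong₂ _+_ (trans (total-⊗ isTwo isLeaf n) (conv-δ p₂ n)) (total-⊗ 𝟙 isOne n) ⟩
  p₂ n + conv C p₁ n
    ∎
  where open ≡-Reasoning

p₁-suc : ∀ n → p₁ (suc n) + p₂ n ≡ C n
p₁-suc n = begin
  p₁ (suc n) + p₂ n
    ≡⟨ cong (p₁ (suc n) +_) (trans (total-⊗ isTwo isLeaf n) (conv-δ p₂ n)) ⟨
  p₁ (suc n) + total (isTwo ⊗ isLeaf) (suc n)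
    ≡⟨ total-+ isOne (isTwo ⊗ isLeaf) (suc n) ⟨
  total (λ t → isOne t + (isTwo ⊗ isLeaf) t) (suc n)
    ≡⟨ total-cong isOne-split (suc n) ⟩
  total (𝟙 ⊗ isLeaf) (suc n)
    ≡⟨ trans (total-⊗ 𝟙 isLeaf n) (conv-δ C n) ⟩
  C n
    ∎
  where open ≡-Reasoning

-- In a pair (g , h), either g = leaf or g = node g₁ g₂ and the pair is rotated to (g₁ , node g₂ h).
a-rotate : ∀ n → conv C p₂ n ≡ p₂ n + conv C a n
a-rotate zero    = refl
a-rotate (suc n) = begin
  1 * p₂ (suc n) + conv (C ∘ suc) p₂ n    ≡⟨ cong₂ _+_ (+-identityʳ _) (conv-cong n (λ i _ → C-suc i) (λ _ _ → refl)) ⟩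
  p₂ (suc n) + conv (conv C C) p₂ n       ≡⟨ cong (p₂ (suc n) +_) (conv-assoc C C p₂ n) ⟩
  p₂ (suc n) + conv C (conv C p₂) n
    ≡⟨ cong (p₂ (suc n) +_) (conv-cong {f = C} n (λ _ _ → refl) (λ i _ → total-⊗ 𝟙 isTwo i)) ⟨
  p₂ (suc n) + conv C (a ∘ suc) n
    ≡⟨ cong (p₂ (suc n) +_)
         (trans (cong (conv C (a ∘ suc) n +_) (*-zeroʳ (C (suc n)))) (+-identityʳ _)) ⟨
  p₂ (suc n) + (conv C (a ∘ suc) n + C (suc n) * a 0)
    ≡⟨ cong (p₂ (suc n) +_) (conv-sucʳ C a n) ⟨
  p₂ (suc n) + conv C a (suc n)           ∎
  where open ≡-Reasoning

conv-+ʳ : ∀ f g h n → conv f (λ i → g i + h i) n ≡ conv f g n + conv f h n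
conv-+ʳ f g h n = trans (conv-comm f _ n) (trans (conv-+ˡ g h f n)
  (cong₂ _+_ (conv-comm g f n) (conv-comm h f n)))

conv-*ʳ : ∀ c f g n → conv f (λ i → c * g i) n ≡ c * conv f g n
conv-*ʳ c f g n = trans (conv-comm f _ n) (trans (conv-*ˡ c g f n) (cong (c *_) (conv-comm g f n)))

-- With y = x C(x), the generating functions P₁, P₂, A of p₁, p₂, a satisfy
-- (1 - 2y)(1 + 2 P₁ + 4 P₂ - A) = 1 - 7 A, whereas (1 - 2y) K = A and (1 - 2y) Z = 1.
cuts-identity : ∀ n → 7 * K n + 2 * p₁ n + 4 * p₂ n + δ n ≡ Z n + a n
cuts-identity n = upTo n n ≤-refl
  where
  -- Strong induction: convolution with `C` uses the identity at all sizes up to `m`.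
  upTo : ∀ n m → m ≤ n → 7 * K m + 2 * p₁ m + 4 * p₂ m + δ m ≡ Z m + a m
  upTo n       zero    _         = refl
  upTo (suc n) (suc m) (s≤s m≤n) = begin
    7 * K (suc m) + 2 * p₁ (suc m) + 4 * p₂ (suc m) + δ (suc m)
      ≡⟨ cong₂ _+_ (cong₂ _+_ (cong (λ k → 7 * k + 2 * p₁ (suc m))
           (trans (K-suc m) (cong (2 * ck +_) (total-⊗ 𝟙 isTwo m)))) (cong (4 *_) (p₂-suc m))) (δ-suc m) ⟩
    7 * (2 * ck + ca′) + 2 * p₁ (suc m) + 4 * (p₂ m + cp₁) + 0
      ≡⟨ combine ck cp₁ ca′ (conv C a m) (conv C Z m) (p₂ m) (p₁ (suc m)) (C m) hyp (a-rotate m) (p₁-suc m) ⟩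
    2 * conv C Z m + ca′
      ≡⟨ cong₂ _+_ (Z-suc m) (total-⊗ 𝟙 isTwo m) ⟨
    Z (suc m) + a (suc m)
      ∎
    where
    open ≡-Reasoning
    ck cp₁ ca′ : ℕ
    ck  = conv C K m
    cp₁ = conv C p₁ m
    ca′ = conv C p₂ m
    -- The identity at smaller sizes, multiplied by y = x C(x).
    hyp : 7 * ck + 2 * cp₁ + 4 * ca′ + C m ≡ conv C Z m + conv C a m
    hyp = begin
      7 * ck + 2 * cp₁ + 4 * ca′ + C m
        ≡⟨ cong₂ _+_ (cong₂ _+_ (cong₂ _+_ (conv-*ʳ 7 C K m) (conv-*ʳ 2 C p₁ m)) (conv-*ʳ 4 C p₂ m)) (conv-δ C m) ⟨
      conv C (λ i → 7 * K i) m + conv C (λ i → 2 * p₁ i) m + conv C (λ i → 4 * p₂ i) m + conv C δ m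
        ≡⟨ cong (λ z → z + conv C (λ i → 4 * p₂ i) m + conv C δ m) (conv-+ʳ C (λ i → 7 * K i) (λ i → 2 * p₁ i) m) ⟨
      conv C (λ i → 7 * K i + 2 * p₁ i) m + conv C (λ i → 4 * p₂ i) m + conv C δ m
        ≡⟨ cong (_+ conv C δ m) (conv-+ʳ C (λ i → 7 * K i + 2 * p₁ i) (λ i → 4 * p₂ i) m) ⟨
      conv C (λ i → 7 * K i + 2 * p₁ i + 4 * p₂ i) m + conv C δ m
        ≡⟨ conv-+ʳ C (λ i → 7 * K i + 2 * p₁ i + 4 * p₂ i) δ m ⟨
      conv C (λ i → 7 * K i + 2 * p₁ i + 4 * p₂ i + δ i) m
        ≡⟨ conv-cong {f = C} m (λ _ _ → refl) (λ i i≤m → upTo n i (≤-trans i≤m m≤n)) ⟩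
      conv C (λ i → Z i + a i) m
        ≡⟨ conv-+ʳ C Z a m ⟩
      conv C Z m + conv C a m
        ∎
    combine : ∀ ck cp₁ ca′ ca cz p₂ p₁′ c →
           7 * ck + 2 * cp₁ + 4 * ca′ + c ≡ cz + ca → ca′ ≡ p₂ + ca → p₁′ + p₂ ≡ c →
           7 * (2 * ck + ca′) + 2 * p₁′ + 4 * (p₂ + cp₁) + 0 ≡ 2 * cz + ca′
    -- Doubling `h₁` accounts for the factor 2y. It brings in the term 2y · 4 P₂, which is the
    -- `8 * ca′` added on both sides.
    combine ck cp₁ ca′ ca cz p₂ p₁′ c h₁ refl refl = +-cancelʳ-≡ (8 * ca′) _ _ (begin
      7 * (2 * ck + ca′) + 2 * p₁′ + 4 * (p₂ + cp₁) + 0 + 8 * ca′  ≡⟨ arith₁ ck cp₁ ca′ p₂ p₁′ ⟩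
      2 * (7 * ck + 2 * cp₁ + 4 * ca′ + (p₁′ + p₂)) + 7 * ca′ + 2 * p₂ ≡⟨ cong (λ z → 2 * z + 7 * ca′ + 2 * p₂) h₁ ⟩
      2 * (cz + ca) + 7 * ca′ + 2 * p₂                             ≡⟨ arith₂ cz ca p₂ ⟩
      2 * cz + ca′ + 8 * ca′                                       ∎)
      where
      arith₁ : ∀ ck cp₁ ca′ p₂ p₁′ →
        7 * (2 * ck + ca′) + 2 * p₁′ + 4 * (p₂ + cp₁) + 0 + 8 * ca′ ≡
        2 * (7 * ck + 2 * cp₁ + 4 * ca′ + (p₁′ + p₂)) + 7 * ca′ + 2 * p₂
      arith₁ = solve-∀
      arith₂ : ∀ cz ca p₂ → 2 * (cz + ca) + 7 * (p₂ + ca) + 2 * p₂ ≡ 2 * cz + (p₂ + ca) + 8 * (p₂ + ca)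
      arith₂ = solve-∀

-- Words repeating UUD

-- The words of the 132-avoiding permutations, split at the last letter r: the letters above r
-- precede those below r.
data Shape : Tree → List ℕ → Set where
  leaf : Shape leaf []
  node : ∀ {g h xs ys r} → Shape g xs → Shape h ys → All (r <_) xs → All (_< r) ys →
         Shape (node g h) (xs ++ ys ++ r ∷ [])

separated : ∀ {r xs ys} → All (r <_) xs → All (_< r) ys → All (λ x → All (_< x) (ys ++ r ∷ [])) xs
separated r<xs ys<r =
  All.map (λ r<x → All.++⁺ (All.map (λ y<r → <-trans y<r r<x) ys<r) (r<x ∷ [])) r<xs

-- Rel m x y: the m-th step (counted from 0) of the pattern UUDUUD… allows y to follow x.
Rel : ℕ → ℕ → ℕ → Set
Rel 0                   x y = x < y
Rel 1                   x y = x < y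
Rel 2                   x y = y ≤ x
Rel (suc (suc (suc m))) x y = Rel m x y

Zig : ℕ → List ℕ → Set
Zig m []           = ⊤
Zig m (x ∷ [])     = ⊤
Zig m (x ∷ y ∷ ys) = Rel m x y × Zig (suc m) (y ∷ ys)

Zig-3+⁻ : ∀ m xs → Zig (3 + m) xs → Zig m xs
Zig-3+⁻ m []           z       = tt
Zig-3+⁻ m (x ∷ [])     z       = tt
Zig-3+⁻ m (x ∷ y ∷ ys) (r , z) = r , Zig-3+⁻ (suc m) (y ∷ ys) z

Zig-3+⁺ : ∀ m xs → Zig m xs → Zig (3 + m) xs
Zig-3+⁺ m []           z       = tt
Zig-3+⁺ m (x ∷ [])     z       = tt
Zig-3+⁺ m (x ∷ y ∷ ys) (r , z) = r , Zig-3+⁺ (suc m) (y ∷ ys) z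

Zig-*3⁻ : ∀ k xs → Zig (k * 3) xs → Zig 0 xs
Zig-*3⁻ zero    xs z = z
Zig-*3⁻ (suc k) xs z = Zig-*3⁻ k xs (Zig-3+⁻ (k * 3) xs z)

Zig-*3⁺ : ∀ k xs → Zig 0 xs → Zig (k * 3) xs
Zig-*3⁺ zero    xs z = z
Zig-*3⁺ (suc k) xs z = Zig-3+⁺ (k * 3) xs (Zig-*3⁺ k xs z)

Zig-take : ∀ k m xs → Zig m xs → Zig m (take k xs)
Zig-take zero          m xs           z       = tt
Zig-take (suc k)       m []           z       = tt
Zig-take (suc k)       m (x ∷ [])     z       = z′ k
  where
  z′ : ∀ k → Zig m (x ∷ take k [])
  z′ zero    = tt
  z′ (suc k) = tt
Zig-take 1             m (x ∷ y ∷ ys) z       = tt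
Zig-take (suc (suc k)) m (x ∷ y ∷ ys) (r , z) = r , Zig-take (suc k) (suc m) (y ∷ ys) z

-- The junction is the step just before number `m + length xs`. The equation on `suc l` names it
-- without truncated subtraction, since `xs` may be empty.
Zig-++⁺ : ∀ m xs ys → Zig m xs → Zig (m + length xs) ys →
          (∀ l → suc l ≡ m + length xs → All (λ x → All (Rel l x) ys) xs) → Zig m (xs ++ ys)
Zig-++⁺ m []            ys       zx zy rel = subst (λ l → Zig l ys) (+-identityʳ m) zy
Zig-++⁺ m (x ∷ [])      []       zx zy rel = tt
Zig-++⁺ m (x ∷ [])      (y ∷ ys) zx zy rel with rel m (+-comm 1 m)
... | (r ∷ _) ∷ _ = r , subst (λ l → Zig l (y ∷ ys)) (+-comm m 1) zy
Zig-++⁺ m (x ∷ x′ ∷ xs) ys (r , zx) zy rel = r ,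
  Zig-++⁺ (suc m) (x′ ∷ xs) ys zx (subst (λ l → Zig l ys) (+-suc m _) zy)
    (λ l eq → All.tail (rel l (trans eq (sym (+-suc m _)))))

-- Only the last letter of the left part meets `y`. It is returned as some `u` with the property `P`
-- shared by all left letters.
Zig-++⁻ : ∀ m x xs y ys {P : ℕ → Set} → All P (x ∷ xs) → Zig m ((x ∷ xs) ++ y ∷ ys) →
          Zig m (x ∷ xs) × (∃[ u ] (P u × Rel (m + length xs) u y)) × Zig (suc (m + length xs)) (y ∷ ys)
Zig-++⁻ m x []        y ys (px ∷ _)   (r , z) rewrite +-identityʳ m = tt , (x , px , r) , z
Zig-++⁻ m x (x′ ∷ xs) y ys (px ∷ pxs) (r , z) with Zig-++⁻ (suc m) x′ xs y ys pxs z
... | zx , rel , zy rewrite +-suc m (length xs) = (r , zx) , rel , zy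

-- Step number `m` follows `suc m` letters, and the D steps are those after a multiple of three
-- letters.
descent : ∀ m {x y} → y < x → Rel m x y → ∃[ k ] suc m ≡ k * 3
descent 0 y<x x<y = contradiction x<y (<⇒≯ y<x)
descent 1 y<x x<y = contradiction x<y (<⇒≯ y<x)
descent 2 y<x y≤x = 1 , refl
descent (suc (suc (suc m))) y<x r with descent m y<x r
... | k , eq = suc k , cong (3 +_) eq

ascent : ∀ m k {x y} → x < y → Rel m x y → suc m ≢ k * 3
ascent 0 (suc zero)    x<y r ()
ascent 1 (suc zero)    x<y r ()
ascent 2 k             x<y y≤x = contradiction y≤x (<⇒≱ x<y)
ascent (suc (suc (suc m))) (suc k) x<y r eq = ascent m k x<y r (+-cancelˡ-≡ 3 _ _ eq)

Rel-down : ∀ k m {x y} → suc m ≡ k * 3 → y < x → Rel m x y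
Rel-down (suc zero)    m refl y<x = <⇒≤ y<x
Rel-down (suc (suc k)) m refl y<x = Rel-down (suc k) _ refl y<x

Rel-up₁ : ∀ k m {x y} → suc m ≡ k * 3 + 1 → x < y → Rel m x y
Rel-up₁ zero    m refl x<y = x<y
Rel-up₁ (suc k) (suc (suc (suc m))) eq x<y = Rel-up₁ k m (+-cancelˡ-≡ 3 _ _ eq) x<y
Rel-up₁ (suc zero) 0 () x<y
Rel-up₁ (suc zero) 1 () x<y
Rel-up₁ (suc zero) 2 () x<y

Rel-up₂ : ∀ k m {x y} → suc m ≡ k * 3 + 2 → x < y → Rel m x y
Rel-up₂ zero    m refl x<y = x<y
Rel-up₂ (suc k) (suc (suc (suc m))) eq x<y = Rel-up₂ k m (+-cancelˡ-≡ 3 _ _ eq) x<y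
Rel-up₂ (suc zero) 0 () x<y
Rel-up₂ (suc zero) 1 () x<y
Rel-up₂ (suc zero) 2 () x<y

-- The longest subsequence following a prefix of UUDUUD...

⊆-++⁻ : ∀ {A : Set} (xs : List A) {ys s} → s ⊆ xs ++ ys →
        ∃[ s₁ ] ∃[ s₂ ] (s ≡ s₁ ++ s₂ × s₁ ⊆ xs × s₂ ⊆ ys)
⊆-++⁻ []       s⊆ = [] , _ , refl , [] , s⊆
⊆-++⁻ (x ∷ xs) (.x ∷ʳ s⊆) with ⊆-++⁻ xs s⊆
... | s₁ , s₂ , eq , p , q = s₁ , s₂ , eq , x ∷ʳ p , q
⊆-++⁻ (x ∷ xs) (refl ∷ s⊆) with ⊆-++⁻ xs s⊆
... | s₁ , s₂ , refl , p , q = x ∷ s₁ , s₂ , refl , refl ∷ p , q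

-- partialʳ is the value after a letter exceeding all others is appended; 3 stands for a new cut.
partial partialʳ : State → ℕ
partial none  = 0
partial spent = 0
partial one   = 1
partial two   = 2
partialʳ none  = 1
partialʳ spent = 0
partialʳ one   = 2
partialʳ two   = 3

reach : Tree → ℕ
reach t = cuts t * 3 + partial (state t)

-- The state `spent` is entered only by a cut at the node and inherited only from the right subtree.
-- The three letters of that cut outweigh the unfinished letters given up on the left, and a lone
-- last letter.
spent⇒cut : ∀ t → state t ≡ spent → 1 ≤ cuts t
spent⇒cut leaf ()
spent⇒cut (node g h) eq with state h in eqh
... | two   = m≤n+m 1 _
... | spent = ≤-trans (spent⇒cut h eqh) (≤-trans (m≤n+m (cuts h) (cuts g)) (m≤m+n _ 0))
... | none with state g
spent⇒cut (node g h) () | none | none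
spent⇒cut (node g h) () | none | spent
spent⇒cut (node g h) () | none | one
spent⇒cut (node g h) () | none | two

none⇒leaf : ∀ t → state t ≡ none → t ≡ leaf
none⇒leaf leaf       eq = refl
none⇒leaf (node g h) eq with trans (sym (none?-join (state g) (state h))) (cong none? eq)
... | ()

partial≤2 : ∀ s → partial s ≤ 2
partial≤2 none  = z≤n
partial≤2 spent = z≤n
partial≤2 one   = s≤s z≤n
partial≤2 two   = ≤-refl

partial-bump : ∀ s → partial s ≤ partial (bump s)
partial-bump none  = z≤n
partial-bump spent = z≤n
partial-bump one   = ≤-refl
partial-bump two   = ≤-refl

1≤partial-bump : ∀ s → 1 ≤ partial (bump s)
1≤partial-bump none  = ≤-refl
1≤partial-bump spent = ≤-refl
1≤partial-bump one   = ≤-refl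
1≤partial-bump two   = s≤s z≤n

reach-node : ∀ g h → reach (node g h) ≡
  cuts g * 3 + cuts h * 3 + (isTwo h * 3 + partial (state (node g h)))
reach-node g h = arith (cuts g) (cuts h) (isTwo h) (partial (state (node g h)))
  where
  arith : ∀ a b c d → (a + b + c) * 3 + d ≡ a * 3 + b * 3 + (c * 3 + d)
  arith = solve-∀

reach-left : ∀ g h → reach g ≤ reach (node g h)
reach-left g h = subst (reach g ≤_) (sym (reach-node g h))
  (subst (reach g ≤_) (sym (+-assoc (cuts g * 3) (cuts h * 3) _)) (+-monoʳ-≤ (cuts g * 3) below))
  where
  below : partial (state g) ≤ cuts h * 3 + (isTwo h * 3 + partial (state (node g h)))
  below with state h in eqh
  ... | none  = ≤-trans (partial-bump (state g)) (m≤n+m _ (cuts h * 3))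
  ... | one   = ≤-trans (partial≤2 (state g)) (m≤n+m _ (cuts h * 3))
  ... | two   = ≤-trans (partial≤2 (state g)) (≤-trans (n≤1+n 2) (m≤n+m 3 (cuts h * 3)))
  ... | spent = ≤-trans (partial≤2 (state g)) (≤-trans (n≤1+n 2)
                  (≤-trans (*-monoˡ-≤ 3 (spent⇒cut h eqh)) (m≤m+n (cuts h * 3) 0)))

-- Strict only for left state `two` and an empty right word: there `join` keeps two unfinished
-- letters, where the last letter alone would give one.
reach-right : ∀ g h → cuts g * 3 + (cuts h * 3 + partialʳ (state h)) ≤ reach (node g h)
reach-right g h = subst₂ _≤_ (+-assoc (cuts g * 3) (cuts h * 3) _) (sym (reach-node g h))
  (+-monoʳ-≤ (cuts g * 3 + cuts h * 3) below)
  where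
  below : partialʳ (state h) ≤ isTwo h * 3 + partial (state (node g h))
  below with state h
  ... | none  = 1≤partial-bump (state g)
  ... | one   = ≤-refl
  ... | two   = ≤-refl
  ... | spent = ≤-refl

whole-rounds : ∀ k c p → p ≤ 2 → k * 3 ≤ c * 3 + p → k * 3 ≤ c * 3
whole-rounds k c p p≤2 k≤ = *-monoˡ-≤ 3 (≤-pred (*-cancelʳ-< 3 k (suc c)
  (≤-<-trans k≤ (subst (_< suc c * 3) (+-comm p (c * 3)) (+-monoˡ-< (c * 3) (s≤s p≤2))))))

private
  Bounded : List ℕ → ℕ → Set
  Bounded ws b = ∀ {s} → s ⊆ ws → Zig 0 s → length s ≤ b

reach-bounded-∷ʳ : ∀ h {ys r} → Bounded ys (reach h) → All (_< r) ys →
                   Bounded (ys ++ r ∷ []) (cuts h * 3 + partialʳ (state h))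
reach-bounded-∷ʳ h {ys} {r} bound ys<r {s} s⊆ z with ⊆-++⁻ ys s⊆
... | s₁ , [] , refl , s₁⊆ , _ rewrite ++-identityʳ s₁ =
  ≤-trans (bound s₁⊆ z) (+-monoʳ-≤ (cuts h * 3) (partial≤partialʳ (state h)))
  where
  partial≤partialʳ : ∀ s → partial s ≤ partialʳ s
  partial≤partialʳ none  = z≤n
  partial≤partialʳ spent = z≤n
  partial≤partialʳ one   = s≤s z≤n
  partial≤partialʳ two   = s≤s (s≤s z≤n)
... | [] , .r ∷ [] , refl , _ , refl ∷ [] = nonzero
  where
  nonzero : 1 ≤ cuts h * 3 + partialʳ (state h)
  nonzero with state h in eq
  ... | none  = m≤n+m 1 _
  ... | one   = ≤-trans (s≤s z≤n) (m≤n+m 2 _)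
  ... | two   = ≤-trans (s≤s z≤n) (m≤n+m 3 _)
  ... | spent = ≤-trans (s≤s z≤n) (≤-trans (*-monoˡ-≤ 3 (spent⇒cut h eq)) (m≤m+n _ 0))
... | x ∷ xs , .r ∷ [] , refl , s₁⊆ , refl ∷ []
  with zx , (u , u<r , rel) , _ ← Zig-++⁻ 0 x xs r [] (All-resp-⊆ s₁⊆ ys<r) z =
  subst (_≤ cuts h * 3 + partialʳ (state h)) (sym (trans (length-++ (x ∷ xs)) (+-comm _ 1)))
    (one-more (bound s₁⊆ zx))
  where
  one-more : suc (length xs) ≤ cuts h * 3 + partial (state h) →
             suc (suc (length xs)) ≤ cuts h * 3 + partialʳ (state h)
  one-more le with state h
  ... | none  = subst (suc (suc (length xs)) ≤_) (sym (+-suc (cuts h * 3) 0)) (s≤s le)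
  ... | one   = subst (suc (suc (length xs)) ≤_) (sym (+-suc (cuts h * 3) 1)) (s≤s le)
  ... | two   = subst (suc (suc (length xs)) ≤_) (sym (+-suc (cuts h * 3) 2)) (s≤s le)
  -- A subsequence of full length `cuts h * 3` must continue with a descent, but `r` exceeds all its
  -- letters; so one that `r` extends is shorter.
  ... | spent = ≤∧≢⇒< le (λ eq → ascent (length xs) (cuts h) u<r rel (trans eq (+-identityʳ _)))

-- A subsequence meeting both parts descends between them, so its left portion has 3k letters. Being
-- at most `reach g`, this number is at most `cuts g * 3`, and the right portion starts the pattern
-- afresh.
reach-bounded : ∀ {t ws} → Shape t ws → Bounded ws (reach t)
reach-bounded leaf [] z = z≤n
reach-bounded (node {g} {h} {xs} {ys} {r} sg sh r<xs ys<r) s⊆ z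
  with ⊆-++⁻ xs s⊆ | reach-bounded-∷ʳ h (reach-bounded sh) ys<r
... | [] , s₂ , refl , _ , s₂⊆ | boundʳ =
  ≤-trans (boundʳ s₂⊆ z) (≤-trans (m≤n+m _ (cuts g * 3)) (reach-right g h))
... | x ∷ s₁ , [] , refl , s₁⊆ , _ | boundʳ =
  ≤-trans (reach-bounded sg (subst (_⊆ xs) (sym (++-identityʳ _)) s₁⊆) z) (reach-left g h)
... | x ∷ s₁ , y ∷ s₂ , refl , s₁⊆ , s₂⊆ | boundʳ
  with zx , (u , zs<u , rel) , zy ← Zig-++⁻ 0 x s₁ y s₂ (All-resp-⊆ s₁⊆ (separated r<xs ys<r)) z
  with k , eq ← descent (length s₁) (All.head (All-resp-⊆ s₂⊆ zs<u)) rel =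
  ≤-trans (subst (_≤ cuts g * 3 + (cuts h * 3 + partialʳ (state h))) (sym (length-++ (x ∷ s₁)))
    (+-mono-≤ (subst (_≤ cuts g * 3) (sym eq)
                 (whole-rounds k (cuts g) (partial (state g)) (partial≤2 (state g))
                   (subst (_≤ reach g) eq (reach-bounded sg s₁⊆ zx))))
              (boundʳ s₂⊆ (Zig-*3⁻ k _ (subst (λ l → Zig l (y ∷ s₂)) eq zy)))))
    (reach-right g h)

private
  Attained : List ℕ → ℕ → Set
  Attained ws b = ∃[ s ] (s ⊆ ws × Zig 0 s × length s ≡ b)

reach-attained-∷ʳ : ∀ h {ys r} → Attained ys (reach h) → All (_< r) ys →
                    Attained (ys ++ r ∷ []) (cuts h * 3 + partialʳ (state h))
reach-attained-∷ʳ h {ys} {r} (s , s⊆ , z , len) ys<r with state h in eqh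
... | none = r ∷ [] , ++⁺ (minimum ys) ⊆-refl , tt , cong (λ t → cuts t * 3 + 1) (sym (none⇒leaf h eqh))
... | spent = s , subst (_⊆ ys ++ r ∷ []) (++-identityʳ s) (++⁺ s⊆ (r ∷ʳ [])) , z , len
... | one = s ++ r ∷ [] , ++⁺ s⊆ ⊆-refl ,
  Zig-++⁺ 0 s (r ∷ []) z tt (λ l eq →
    All.map (λ x<r → Rel-up₁ (cuts h) l (trans eq len) x<r ∷ []) (All-resp-⊆ s⊆ ys<r)) ,
  trans (length-++ s) (trans (cong (_+ 1) len) (+-assoc (cuts h * 3) 1 1))
... | two = s ++ r ∷ [] , ++⁺ s⊆ ⊆-refl ,
  Zig-++⁺ 0 s (r ∷ []) z tt (λ l eq →
    All.map (λ x<r → Rel-up₂ (cuts h) l (trans eq len) x<r ∷ []) (All-resp-⊆ s⊆ ys<r)) ,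
  trans (length-++ s) (trans (cong (_+ 1) len) (+-assoc (cuts h * 3) 2 1))

-- The first `cuts g * 3` letters of an optimum on the left, followed by an optimum on the right,
-- attain the bound in all cases but one.
reach-attained : ∀ {t ws} → Shape t ws → Attained ws (reach t)
reach-attained leaf = [] , [] , tt , refl
reach-attained (node {g} {h} {xs} {ys} {r} sg sh r<xs ys<r)
  with s₁ , s₁⊆ , z₁ , len₁ ← reach-attained sg
     | s₂ , s₂⊆ , z₂ , len₂ ← reach-attained-∷ʳ h (reach-attained sh) ys<r
  = pick (state g) (state h) refl refl
  where
  s₁′ : List ℕ
  s₁′ = take (cuts g * 3) s₁
  s₁′⊆ : s₁′ ⊆ xs
  s₁′⊆ = ⊆-trans (take-⊆ (cuts g * 3) s₁) s₁⊆
  len₁′ : length s₁′ ≡ cuts g * 3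
  len₁′ = trans (length-take (cuts g * 3) s₁)
    (m≤n⇒m⊓n≡m (subst (cuts g * 3 ≤_) (sym len₁) (m≤m+n _ (partial (state g)))))
  joined : ∀ {s t} → state g ≡ s → state h ≡ t → partialʳ t ≡ two? t * 3 + partial (join s t) →
           Attained (xs ++ ys ++ r ∷ []) (reach (node g h))
  joined refl refl eq = s₁′ ++ s₂ , ++⁺ s₁′⊆ s₂⊆ ,
    Zig-++⁺ 0 s₁′ s₂ (Zig-take (cuts g * 3) 0 s₁ z₁)
      (subst (λ l → Zig l s₂) (sym len₁′) (Zig-*3⁺ (cuts g) s₂ z₂))
      (λ l eq → All.map (λ zs<x → All.map (Rel-down (cuts g) l (trans eq len₁′)) (All-resp-⊆ s₂⊆ zs<x))
        (All-resp-⊆ s₁′⊆ (separated r<xs ys<r))) ,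
    (begin
      length (s₁′ ++ s₂)                                    ≡⟨ length-++ s₁′ ⟩
      length s₁′ + length s₂                                ≡⟨ cong₂ _+_ len₁′ len₂ ⟩
      cuts g * 3 + (cuts h * 3 + partialʳ (state h))        ≡⟨ +-assoc (cuts g * 3) _ _ ⟨
      cuts g * 3 + cuts h * 3 + partialʳ (state h)          ≡⟨ cong (cuts g * 3 + cuts h * 3 +_) eq ⟩
      cuts g * 3 + cuts h * 3 + (isTwo h * 3 + partial (state (node g h))) ≡⟨ reach-node g h ⟨
      reach (node g h)                                      ∎)
    where open ≡-Reasoning
  left : reach g ≡ reach (node g h) → Attained (xs ++ ys ++ r ∷ []) (reach (node g h))
  left eq = s₁ , subst (_⊆ xs ++ ys ++ r ∷ []) (++-identityʳ s₁) (++⁺ s₁⊆ (minimum (ys ++ r ∷ []))) ,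
    z₁ , trans len₁ eq
  pick : ∀ s t → state g ≡ s → state h ≡ t → Attained (xs ++ ys ++ r ∷ []) (reach (node g h))
  -- The exceptional case: the left optimum keeps two unfinished letters, whereas switching to the
  -- lone `r` would leave one.
  pick two none  eqg eqh = left (lemma (none⇒leaf h eqh))
    where
    lemma : h ≡ leaf → reach g ≡ reach (node g h)
    lemma refl rewrite eqg | +-identityʳ (cuts g) | +-identityʳ (cuts g) = refl
  pick none  none eqg eqh = joined eqg eqh refl
  pick spent none eqg eqh = joined eqg eqh refl
  pick one   none eqg eqh = joined eqg eqh refl
  pick s one   eqg eqh = joined eqg eqh refl
  pick s two   eqg eqh = joined eqg eqh refl
  pick s spent eqg eqh = joined eqg eqh refl

reach-≥ : ∀ t → cuts t * 3 ≤ reach t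
reach-≥ t = m≤m+n (cuts t * 3) _

reach-≤ : ∀ t → reach t ≤ cuts t * 3 + 2
reach-≤ t = +-monoʳ-≤ (cuts t * 3) (partial≤2 (state t))

-- From prefixes of UUDUUD... to complete repetitions of UUD

rounds : ℕ → List Step
rounds k = concat (replicate k (U ∷ U ∷ D ∷ []))

step-U⁻ : ∀ {n} (x y : Fin n) → step x y ≡ U → toℕ x < toℕ y
step-U⁻ x y eq with x Fin.<? y
... | yes x<y = x<y
step-U⁻ x y () | no _

step-D⁻ : ∀ {n} (x y : Fin n) → step x y ≡ D → toℕ y ≤ toℕ x
step-D⁻ x y eq with x Fin.<? y
... | no x≮y = ≮⇒≥ x≮y
step-D⁻ x y () | yes _

step-U⁺ : ∀ {n} (x y : Fin n) → toℕ x < toℕ y → step x y ≡ U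
step-U⁺ x y x<y with x Fin.<? y
... | yes _  = refl
... | no x≮y = contradiction x<y x≮y

step-D⁺ : ∀ {n} (x y : Fin n) → toℕ y ≤ toℕ x → step x y ≡ D
step-D⁺ x y y≤x with x Fin.<? y
... | yes x<y = contradiction x<y (≤⇒≯ y≤x)
... | no _    = refl

rounds⇒Zig : ∀ {n} k (s : List (Fin n)) → upDown s ≡ rounds k → Zig 0 (map toℕ s)
rounds⇒Zig k       []                  eq = tt
rounds⇒Zig k       (x ∷ [])            eq = tt
rounds⇒Zig (suc k) (x ∷ y ∷ z ∷ w ∷ s) eq =
  let eq₁ , eq′ = ∷-injective eq
      eq₂ , eq″ = ∷-injective eq′
      eq₃ , eq‴ = ∷-injective eq″
  in step-U⁻ x y eq₁ , step-U⁻ y z eq₂ , step-D⁻ z w eq₃ ,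
     Zig-3+⁺ 0 (map toℕ (w ∷ s)) (rounds⇒Zig k (w ∷ s) eq‴)
rounds⇒Zig zero    (x ∷ y ∷ s)      ()
rounds⇒Zig (suc k) (x ∷ y ∷ [])     eq with ∷-injectiveʳ eq
... | ()
rounds⇒Zig (suc k) (x ∷ y ∷ z ∷ []) eq with ∷-injectiveʳ (∷-injectiveʳ eq)
... | ()

Zig⇒rounds : ∀ {n} k (s : List (Fin n)) → 1 + k * 3 ≤ length s → Zig 0 (map toℕ s) →
             upDown (take (1 + k * 3) s) ≡ rounds k
Zig⇒rounds zero    (x ∷ s)             le z = refl
Zig⇒rounds (suc k) (x ∷ y ∷ z ∷ w ∷ s) (s≤s (s≤s (s≤s le))) (x<y , y<z , w≤z , zig) =
  cong₂ _∷_ (step-U⁺ x y x<y) (cong₂ _∷_ (step-U⁺ y z y<z) (cong₂ _∷_ (step-D⁺ z w w≤z)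
    (Zig⇒rounds k (w ∷ s) le (Zig-3+⁻ 0 (map toℕ (w ∷ s)) zig))))
Zig⇒rounds (suc k) (x ∷ y ∷ z ∷ []) (s≤s (s≤s (s≤s ()))) zig

∈-subsequences⁺ : ∀ {A : Set} {s xs : List A} → s ⊆ xs → s ∈ subsequences xs
∈-subsequences⁺ []                  = here refl
∈-subsequences⁺ {xs = x ∷ xs} (.x ∷ʳ s⊆) = ∈-++⁺ʳ (map (x ∷_) (subsequences xs)) (∈-subsequences⁺ s⊆)
∈-subsequences⁺ (refl ∷ s⊆)         = ∈-++⁺ˡ (∈-map⁺ _ (∈-subsequences⁺ s⊆))

∈-subsequences⁻ : ∀ {A : Set} {s} (xs : List A) → s ∈ subsequences xs → s ⊆ xs
∈-subsequences⁻ []       (here refl) = []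
∈-subsequences⁻ (x ∷ xs) s∈ with ∈-++⁻ (map (x ∷_) (subsequences xs)) s∈
... | inj₂ s∈ʳ = x ∷ʳ ∈-subsequences⁻ xs s∈ʳ
... | inj₁ s∈ˡ with ∈-map⁻ (x ∷_) s∈ˡ
...   | s′ , s′∈ , refl = refl ∷ ∈-subsequences⁻ xs s′∈

⊆-map⁻ : ∀ {A B : Set} {f : A → B} xs {s} → s ⊆ map f xs → ∃[ s′ ] (s′ ⊆ xs × s ≡ map f s′)
⊆-map⁻ []       []           = [] , [] , refl
⊆-map⁻ (x ∷ xs) (_ ∷ʳ s⊆)    with ⊆-map⁻ xs s⊆
... | s′ , s′⊆ , eq = s′ , x ∷ʳ s′⊆ , eq
⊆-map⁻ (x ∷ xs) (refl ∷ s⊆) with ⊆-map⁻ xs s⊆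
... | s′ , s′⊆ , refl = x ∷ s′ , refl ∷ s′⊆ , refl

letters : ∀ {n k} → Vec (Fin n) k → List ℕ
letters v = map toℕ (toList v)

longest-≤ : ∀ {n t} (σ : Word n) → Shape t (letters σ) → longest UUD σ ≤ reach t
longest-≤ {n} {t} σ shape = max≤v⁺ z≤n (All.map⁺ (All.tabulate bound))
  where
  bound : ∀ {s} → s ∈ filter (repeats? UUD) (subsequences (toList σ)) → length s ≤ reach t
  bound {s} s∈ with ∈-filter⁻ (repeats? UUD) {xs = subsequences (toList σ)} s∈
  ... | s∈′ , k , _ , eq = subst (_≤ reach t) (length-map toℕ s)
    (reach-bounded shape (⊆-map⁺ toℕ (∈-subsequences⁻ (toList σ) s∈′)) (rounds⇒Zig k s eq))

-- Truncating `s` to 3k + 1 letters leaves complete patterns and removes at most two letters. If k =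
-- 0, which `Repeats` excludes, `s` has at most three letters.
Zig-≤-longest : ∀ {n} (σ : Word n) {s} → s ⊆ toList σ → Zig 0 (map toℕ s) → length s ≤ longest UUD σ + 3
Zig-≤-longest {n} σ {s} s⊆ zig with length s in len
... | zero  = z≤n
... | suc q with q ℕ./ 3 in eqk | m≡m%n+[m/n]*n q 3 | m%n<n q 3
...   | zero  | q≡ | q%3<3 = ≤-trans (subst (λ q → suc q ≤ 3) (sym (trans q≡ (+-identityʳ _))) q%3<3) (m≤n+m 3 _)
...   | suc k | q≡ | q%3<3 = begin
  suc q                            ≡⟨ cong suc q≡ ⟩
  suc (q % 3 + suc k * 3)          ≤⟨ s≤s (+-monoˡ-≤ (suc k * 3) (≤-trans (n≤1+n _) q%3<3)) ⟩
  suc (3 + suc k * 3)              ≡⟨ +-comm 3 (1 + suc k * 3) ⟩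
  1 + suc k * 3 + 3                ≡⟨ cong (_+ 3) len′ ⟨
  length s″ + 3                    ≤⟨ +-monoˡ-≤ 3 (All.lookup (xs≤max 0 lengths) (∈-map⁺ length s″∈)) ⟩
  longest UUD σ + 3                ∎
  where
  open ≤-Reasoning
  s″ : List (Fin n)
  s″ = take (1 + suc k * 3) s
  lengths : List ℕ
  lengths = map length (filter (repeats? UUD) (subsequences (toList σ)))
  enough : 1 + suc k * 3 ≤ length s
  enough = subst (1 + suc k * 3 ≤_) (trans (cong suc (sym q≡)) (sym len))
    (s≤s (m≤n+m (suc k * 3) (q % 3)))
  len′ : length s″ ≡ 1 + suc k * 3
  len′ = trans (length-take (1 + suc k * 3) s) (m≤n⇒m⊓n≡m enough)
  s″∈ : s″ ∈ filter (repeats? UUD) (subsequences (toList σ))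
  s″∈ = ∈-filter⁺ (repeats? UUD)
    (∈-subsequences⁺ (⊆-trans (take-⊆ (1 + suc k * 3) s) s⊆))
    (suc k , s≤s z≤n , Zig⇒rounds (suc k) s enough zig)

longest-≥ : ∀ {n t} (σ : Word n) → Shape t (letters σ) → reach t ≤ longest UUD σ + 3
longest-≥ σ shape with reach-attained shape
... | s , s⊆ , zig , len with ⊆-map⁻ (toList σ) s⊆
...   | s′ , s′⊆ , refl = subst (_≤ longest UUD σ + 3) (trans (sym (length-map toℕ s′)) len)
  (Zig-≤-longest σ s′⊆ zig)

-- Trees and 132-avoiding words

-- The offset `o` is the least value in use: the word of a tree permutes an interval of consecutive
-- values, with those of `h` at the bottom, then the last letter, then those of `g`.
word : ℕ → Tree → List ℕ
word o leaf       = []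
word o (node g h) = word (suc (o + size h)) g ++ word o h ++ (o + size h) ∷ []

Within : ℕ → ℕ → ℕ → Set
Within o k x = o ≤ x × x < o + k

word-within : ∀ o t → All (Within o (size t)) (word o t)
word-within o leaf       = []
word-within o (node g h) = All.++⁺
  (All.map (λ (p , q) → ≤-trans (≤-trans (m≤m+n o (size h)) (n≤1+n _)) p ,
     <-≤-trans q (≤-reflexive (arith o (size g) (size h)))) (word-within (suc (o + size h)) g))
  (All.++⁺
    (All.map (λ (p , q) → p , <-≤-trans q (≤-trans (m≤m+n _ (suc (size g))) (≤-reflexive (arith′ o (size g) (size h)))))
       (word-within o h))
    ((m≤m+n o (size h) , subst (o + size h <_) (arith o (size g) (size h)) (m≤m+n (suc (o + size h)) (size g))) ∷ []))
  where
  arith : ∀ o a b → suc (o + b) + a ≡ o + suc (a + b)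
  arith = solve-∀
  arith′ : ∀ o a b → o + b + suc a ≡ o + suc (a + b)
  arith′ = solve-∀

word-shape : ∀ o t → Shape t (word o t)
word-shape o leaf       = leaf
word-shape o (node g h) = node (word-shape _ g) (word-shape o h)
  (All.map proj₁ (word-within _ g)) (All.map proj₂ (word-within o h))

shape-length : ∀ {t ws} → Shape t ws → length ws ≡ size t
shape-length leaf = refl
shape-length (node {g} {h} {xs} {ys} {r} sg sh _ _) = begin
  length (xs ++ ys ++ r ∷ [])       ≡⟨ length-++ xs ⟩
  length xs + length (ys ++ r ∷ []) ≡⟨ cong₂ _+_ (shape-length sg) (trans (length-++ ys) (+-comm _ 1)) ⟩
  size g + suc (length ys)          ≡⟨ cong (λ l → size g + suc l) (shape-length sh) ⟩
  size g + suc (size h)             ≡⟨ +-suc (size g) (size h) ⟩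
  suc (size g + size h)             ∎
  where open ≡-Reasoning

split-within : ∀ {xs ys r o k} → All (r <_) xs → All (_< r) ys → All (Within o k) (xs ++ ys ++ r ∷ []) →
  ∃[ a ] ∃[ b ] (r ≡ o + b × k ≡ suc (a + b) × All (Within (suc r) a) xs × All (Within o b) ys)
split-within {xs} {ys} {r} {o} {k} r<xs ys<r all
  with wx ← All.++⁻ˡ xs all
     | wy ← All.++⁻ˡ ys (All.++⁻ʳ xs all)
     | (o≤r , r<o+k) ∷ [] ← All.++⁻ʳ ys (All.++⁻ʳ xs all)
  with b , refl ← m≤n⇒∃[o]m+o≡n o≤r
  with a , k≡ ← m≤n⇒∃[o]m+o≡n (+-cancelˡ-< o b k r<o+k) =
  a , b , refl , trans (sym k≡) (cong suc (+-comm b a)) ,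
  All.zipWith (λ (p , (_ , q)) → p , <-≤-trans q (≤-reflexive (trans (cong (o +_) (sym k≡)) (arith o a b))))
    (r<xs , wx) ,
  All.zipWith (λ (p , (q , _)) → q , p) (ys<r , wy)
  where
  arith : ∀ o a b → o + (suc b + a) ≡ suc (o + b) + a
  arith = solve-∀

-- A pigeonhole argument along the tree: the last letter confines the two subwords to disjoint
-- intervals.
shape-size : ∀ {t ws o k} → Shape t ws → All (Within o k) ws → size t ≤ k
shape-size leaf all = z≤n
shape-size (node sg sh r<xs ys<r) all with split-within r<xs ys<r all
... | a , b , refl , refl , wx , wy = s≤s (+-mono-≤ (shape-size sg wx) (shape-size sh wy))

-- The interval has exactly as many values as there are letters. Each part fits into its own
-- interval by `shape-size` and the sizes add up, so both intervals are full, which fixes the last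
-- letter and then both parts.
shape-word : ∀ {t ws o} → Shape t ws → All (Within o (size t)) ws → ws ≡ word o t
shape-word leaf all = refl
shape-word {o = o} (node {g} {h} {xs} {ys} sg sh r<xs ys<r) all with split-within r<xs ys<r all
... | a , b , refl , eq , wx , wy = subst (λ b → xs ++ ys ++ (o + b) ∷ [] ≡ word o (node g h)) (sym b≡)
  (cong₂ (λ u v → u ++ v ++ (o + size h) ∷ [])
    (shape-word sg (subst₂ (λ b a → All (Within (suc (o + b)) a) xs) b≡ a≡ wx))
    (shape-word sh (subst (λ b → All (Within o b) ys) b≡ wy)))
  where
  a≥ : size g ≤ a
  a≥ = shape-size sg wx
  b≥ : size h ≤ b
  b≥ = shape-size sh wy
  sum≡ : a + b ≡ size g + size h
  sum≡ = sym (suc-injective eq)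
  b≡ : b ≡ size h
  b≡ = ≤-antisym (+-cancelˡ-≤ (size g) b (size h) (≤-trans (+-monoˡ-≤ b a≥) (≤-reflexive sum≡))) b≥
  a≡ : a ≡ size g
  a≡ = +-cancelʳ-≡ b a (size g) (trans sum≡ (cong (size g +_) (sym b≡)))

++-injective : ∀ {A : Set} (xs xs′ : List A) {ys ys′} → length xs ≡ length xs′ →
               xs ++ ys ≡ xs′ ++ ys′ → xs ≡ xs′ × ys ≡ ys′
++-injective []       []         len eq = refl , eq
++-injective (x ∷ xs) (x′ ∷ xs′) len eq with ∷-injective eq
... | refl , eq′ with ++-injective xs xs′ (suc-injective len) eq′
...   | refl , eq″ = refl , eq″

word-length : ∀ o t → length (word o t) ≡ size t
word-length o t = shape-length (word-shape o t)

-- The last letter reveals `size h`, the length then gives `size g`, and the rest can be cut into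
-- the two subwords.
word-injective : ∀ o t t′ → word o t ≡ word o t′ → t ≡ t′
word-injective o leaf       leaf         eq = refl
word-injective o leaf       (node g′ h′) eq with trans (cong length eq) (word-length o (node g′ h′))
... | ()
word-injective o (node g h) leaf         eq with trans (sym (cong length eq)) (word-length o (node g h))
... | ()
word-injective o (node g h) (node g′ h′) eq = cong₂ node g≡ h≡
  where
  o+ : ℕ → ℕ
  o+ k = suc (o + k)
  last≡ : word (o+ (size h)) g ++ word o h ≡ word (o+ (size h′)) g′ ++ word o h′ × o + size h ≡ o + size h′
  last≡ = ∷ʳ-injective _ _ (trans (++-assoc (word (o+ (size h)) g) (word o h) _)
    (trans eq (sym (++-assoc (word (o+ (size h′)) g′) (word o h′) _))))
  size-h : size h ≡ size h′
  size-h = +-cancelˡ-≡ o _ _ (proj₂ last≡)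
  size-g : size g ≡ size g′
  size-g = +-cancelʳ-≡ (size h) _ _ (trans
    (suc-injective (trans (sym (word-length o (node g h))) (trans (cong length eq) (word-length o (node g′ h′)))))
    (cong (size g′ +_) (sym size-h)))
  parts : word (o+ (size h)) g ≡ word (o+ (size h′)) g′ × word o h ≡ word o h′
  parts = ++-injective _ _ (trans (word-length _ g) (trans size-g (sym (word-length _ g′)))) (proj₁ last≡)
  g≡ : g ≡ g′
  g≡ = word-injective (o+ (size h)) g g′ (trans (proj₁ parts) (cong (λ b → word (o+ b) g′) (sym size-h)))
  h≡ : h ≡ h′
  h≡ = word-injective o h h′ (proj₂ parts)

-- Avoidance of 132 on lists of letters

Av : List ℕ → Set
Av []       = ⊤
Av (x ∷ xs) = AllPairs (λ c b → ¬ (x < b × b < c)) xs × Av xs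

-- An occurrence beginning in `xs` ends in a larger letter, hence also in `xs`; all others lie in
-- `zs`.
Av-++⁺ : ∀ xs {zs} → Av xs → Av zs → All (λ x → All (_< x) zs) xs → Av (xs ++ zs)
Av-++⁺ []       _        az _            = az
Av-++⁺ (x ∷ xs) (px , ax) az (zs<x ∷ sep) =
  AllPairs.++⁺ px (pairs zs<x) (All.tabulate λ _ → All.map (λ z<x (x<z , _) → <⇒≯ z<x x<z) zs<x) ,
  Av-++⁺ xs ax az sep
  where
  pairs : ∀ {x zs} → All (_< x) zs → AllPairs (λ c b → ¬ (x < b × b < c)) zs
  pairs []          = []
  pairs (_ ∷ zs<x) = All.map (λ z<x (x<z , _) → <⇒≯ z<x x<z) zs<x ∷ pairs zs<x

Av-∷ʳ⁺ : ∀ ys {r} → Av ys → All (_< r) ys → Av (ys ++ r ∷ [])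
Av-∷ʳ⁺ []       _         _            = [] , tt
Av-∷ʳ⁺ (y ∷ ys) (py , ay) (_ ∷ ys<r) =
  AllPairs.++⁺ py ([] ∷ []) (All.map (λ c<r → (λ (_ , r<c) → <⇒≯ c<r r<c) ∷ []) ys<r) , Av-∷ʳ⁺ ys ay ys<r

shape⇒Av : ∀ {t ws} → Shape t ws → Av ws
shape⇒Av leaf = tt
shape⇒Av (node {xs = xs} {ys} sg sh r<xs ys<r) =
  Av-++⁺ xs (shape⇒Av sg) (Av-∷ʳ⁺ ys (shape⇒Av sh) ys<r) (separated r<xs ys<r)

shape⇒Unique : ∀ {t ws} → Shape t ws → Unique ws
shape⇒Unique leaf = []
shape⇒Unique (node sg sh r<xs ys<r) = AllPairs.++⁺ (shape⇒Unique sg)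
  (AllPairs.++⁺ (shape⇒Unique sh) ([] ∷ []) (All.map (λ y<r → <⇒≢ y<r ∷ []) ys<r))
  (All.map (All.map (≢-sym ∘ <⇒≢)) (separated r<xs ys<r))

AllPairs-resp-⊆ : ∀ {A : Set} {R : A → A → Set} {xs ys} → xs ⊆ ys → AllPairs R ys → AllPairs R xs
AllPairs-resp-⊆ []          []         = []
AllPairs-resp-⊆ (y ∷ʳ s⊆)   (_ ∷ pys)  = AllPairs-resp-⊆ s⊆ pys
AllPairs-resp-⊆ (refl ∷ s⊆) (py ∷ pys) = All-resp-⊆ s⊆ py ∷ AllPairs-resp-⊆ s⊆ pys

Av-resp-⊆ : ∀ {xs ys} → xs ⊆ ys → Av ys → Av xs
Av-resp-⊆ []          _        = tt
Av-resp-⊆ (y ∷ʳ s⊆)   (_ , ay) = Av-resp-⊆ s⊆ ay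
Av-resp-⊆ (refl ∷ s⊆) (p , ay) = AllPairs-resp-⊆ s⊆ p , Av-resp-⊆ s⊆ ay

-- If x < r, a later c > r would make x c r an occurrence of 132. So once a letter lies below `r`,
-- all letters between it and `r` do.
split-at : ∀ xs {r} → Av (xs ++ r ∷ []) → Unique (xs ++ r ∷ []) →
           ∃[ ys ] ∃[ zs ] (xs ≡ ys ++ zs × All (r <_) ys × All (_< r) zs)
split-at []       _         _        = [] , [] , refl , [] , []
split-at (x ∷ xs) {r} (px , ax) (ux ∷ u) with <-cmp x r
... | tri≈ _ x≡r _ = contradiction x≡r (All.head (All.++⁻ʳ xs ux))
... | tri< x<r _ _ = [] , x ∷ xs , refl , [] , x<r ∷ below xs px u
  where
  below : ∀ xs → AllPairs (λ c b → ¬ (x < b × b < c)) (xs ++ r ∷ []) → Unique (xs ++ r ∷ []) → All (_< r) xs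
  below []       _        _          = []
  below (c ∷ xs) (p ∷ ps) (uc ∷ us) =
    ≤∧≢⇒< (≮⇒≥ λ r<c → All.head (All.++⁻ʳ xs p) (x<r , r<c)) (All.head (All.++⁻ʳ xs uc)) ∷ below xs ps us
... | tri> _ _ r<x with split-at xs ax u
...   | ys , zs , refl , r<ys , zs<r = x ∷ ys , zs , refl , r<x ∷ r<ys , zs<r

-- The bound `k` is fuel, since the two parts of the split are not structurally smaller than `ws`.
∃shape : ∀ k ws → length ws ≤ k → Av ws → Unique ws → ∃[ t ] Shape t ws
∃shape k ws len av u with initLast ws
... | [] = leaf , leaf
∃shape zero ws len av u | xs ∷ʳ′ r =
  contradiction (subst (_≤ 0) (trans (length-++ xs) (+-comm _ 1)) len) λ ()
∃shape (suc k) ws len av u | xs ∷ʳ′ r with split-at xs av u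
... | ys , zs , refl , r<ys , zs<r = attach
  (∃shape k ys (≤-trans (m≤m+n _ _) short) (Av-resp-⊆ ys⊆ av) (AllPairs-resp-⊆ ys⊆ u))
  (∃shape k zs (≤-trans (m≤n+m _ (length ys)) short) (Av-resp-⊆ zs⊆ av) (AllPairs-resp-⊆ zs⊆ u))
  where
  short : length ys + length zs ≤ k
  short = ≤-pred (subst (_≤ suc k)
    (trans (length-++ (ys ++ zs)) (trans (+-comm _ 1) (cong suc (length-++ ys)))) len)
  ys⊆ : ys ⊆ (ys ++ zs) ++ r ∷ []
  ys⊆ = ++⁺ʳ (r ∷ []) (++⁺ʳ zs ⊆-refl)
  zs⊆ : zs ⊆ (ys ++ zs) ++ r ∷ []
  zs⊆ = ++⁺ʳ (r ∷ []) (++⁺ˡ ys ⊆-refl)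
  attach : ∃[ g ] Shape g ys → ∃[ h ] Shape h zs → ∃[ t ] Shape t ((ys ++ zs) ++ r ∷ [])
  attach (g , sg) (h , sh) =
    node g h , subst (Shape (node g h)) (sym (++-assoc ys zs (r ∷ []))) (node sg sh r<ys zs<r)

-- Transfer between vectors and lists of numbers

All-letters⁺ : ∀ {n k} {P : ℕ → Set} (v : Vec (Fin n) k) → (∀ i → P (toℕ (lookup v i))) → All P (letters v)
All-letters⁺ []      p = []
All-letters⁺ (x ∷ v) p = p Fin.zero ∷ All-letters⁺ v (p ∘ Fin.suc)

All-letters⁻ : ∀ {n k} {P : ℕ → Set} (v : Vec (Fin n) k) → All P (letters v) → ∀ i → P (toℕ (lookup v i))
All-letters⁻ (x ∷ v) (p ∷ ps) Fin.zero    = p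
All-letters⁻ (x ∷ v) (p ∷ ps) (Fin.suc i) = All-letters⁻ v ps i

AllPairs-letters⁺ : ∀ {n k} {R : ℕ → ℕ → Set} (v : Vec (Fin n) k) →
  (∀ i j → i Fin.< j → R (toℕ (lookup v i)) (toℕ (lookup v j))) → AllPairs R (letters v)
AllPairs-letters⁺ []      p = []
AllPairs-letters⁺ (x ∷ v) p = All-letters⁺ v (λ j → p Fin.zero (Fin.suc j) (s≤s z≤n)) ∷
  AllPairs-letters⁺ v (λ i j i<j → p (Fin.suc i) (Fin.suc j) (s≤s i<j))

AllPairs-letters⁻ : ∀ {n k} {R : ℕ → ℕ → Set} (v : Vec (Fin n) k) → AllPairs R (letters v) →
  ∀ i j → i Fin.< j → R (toℕ (lookup v i)) (toℕ (lookup v j))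
AllPairs-letters⁻ (x ∷ v) (p ∷ ps) Fin.zero    (Fin.suc j) _         = All-letters⁻ v p j
AllPairs-letters⁻ (x ∷ v) (p ∷ ps) (Fin.suc i) (Fin.suc j) (s≤s i<j) = AllPairs-letters⁻ v ps i j i<j

Av-letters⁺ : ∀ {n k} (v : Vec (Fin n) k) →
  (∀ i j l → i Fin.< j → j Fin.< l → ¬ (lookup v i Fin.< lookup v l × lookup v l Fin.< lookup v j)) →
  Av (letters v)
Av-letters⁺ []      p = tt
Av-letters⁺ (x ∷ v) p =
  AllPairs-letters⁺ v (λ j l j<l → p Fin.zero (Fin.suc j) (Fin.suc l) (s≤s z≤n) (s≤s j<l)) ,
  Av-letters⁺ v (λ i j l i<j j<l → p (Fin.suc i) (Fin.suc j) (Fin.suc l) (s≤s i<j) (s≤s j<l))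

Av-letters⁻ : ∀ {n k} (v : Vec (Fin n) k) → Av (letters v) →
  ∀ i j l → i Fin.< j → j Fin.< l → ¬ (lookup v i Fin.< lookup v l × lookup v l Fin.< lookup v j)
Av-letters⁻ (x ∷ v) (p , _)  Fin.zero    (Fin.suc j) (Fin.suc l) _         (s≤s j<l) = AllPairs-letters⁻ v p j l j<l
Av-letters⁻ (x ∷ v) (_ , av) (Fin.suc i) (Fin.suc j) (Fin.suc l) (s≤s i<j) (s≤s j<l) = Av-letters⁻ v av i j l i<j j<l

pattern 0F = Fin.zero
pattern 1F = Fin.suc Fin.zero
pattern 2F = Fin.suc (Fin.suc Fin.zero)

occurs-132 : ∀ {n} (σ : Word n) i j l → lookup σ i Fin.< lookup σ l → lookup σ l Fin.< lookup σ j →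
             Occurs τ₁₃₂ σ (i ∷ j ∷ l ∷ [])
occurs-132 σ i j l i<l l<j = occ
  where
  no-loop : ∀ {m} x → lookup σ x Fin.< lookup σ x → m
  no-loop x x<x = contradiction x<x (Fin.<-irrefl refl)
  occ : Occurs τ₁₃₂ σ (i ∷ j ∷ l ∷ [])
  occ 0F 0F = mk⇔ (λ ()) (no-loop i)
  occ 0F 1F = mk⇔ (λ _ → <-trans i<l l<j) (λ _ → s≤s z≤n)
  occ 0F 2F = mk⇔ (λ _ → i<l) (λ _ → s≤s z≤n)
  occ 1F 0F = mk⇔ (λ ()) (λ j<i → contradiction (<-trans i<l l<j) (<⇒≯ j<i))
  occ 1F 1F = mk⇔ (λ { (s≤s (s≤s ())) }) (no-loop j)
  occ 1F 2F = mk⇔ (λ { (s≤s ()) }) (λ j<l → contradiction l<j (<⇒≯ j<l))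
  occ 2F 0F = mk⇔ (λ ()) (λ l<i → contradiction i<l (<⇒≯ l<i))
  occ 2F 1F = mk⇔ (λ _ → l<j) (λ _ → s≤s (s≤s z≤n))
  occ 2F 2F = mk⇔ (λ { (s≤s ()) }) (no-loop l)

Avoids⇒Av : ∀ {n} (σ : Word n) → Avoids τ₁₃₂ σ → Av (letters σ)
Avoids⇒Av σ avoids = Av-letters⁺ σ λ i j l i<j j<l (σi<σl , σl<σj) →
  avoids (i , j , l , i<j , j<l , occurs-132 σ i j l σi<σl σl<σj)

Av⇒Avoids : ∀ {n} (σ : Word n) → Av (letters σ) → Avoids τ₁₃₂ σ
Av⇒Avoids σ av (i , j , l , i<j , j<l , occ) = Av-letters⁻ σ av i j l i<j j<l
  (Equivalence.to (occ 0F 2F) (s≤s z≤n) , Equivalence.to (occ 2F 1F) (s≤s (s≤s z≤n)))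

Unique-letters⁺ : ∀ {n k} {v : Vec (Fin n) k} → Vec.Unique v → Unique (letters v)
Unique-letters⁺ VecPairs.[]       = []
Unique-letters⁺ (px VecPairs.∷ u) =
  All.map⁺ (All.map (λ x≢y → x≢y ∘ Fin.toℕ-injective) (VecAll.toList⁺ px)) ∷ Unique-letters⁺ u

Unique-letters⁻ : ∀ {n k} (v : Vec (Fin n) k) → Unique (letters v) → Vec.Unique v
Unique-letters⁻ []      _        = VecPairs.[]
Unique-letters⁻ (x ∷ v) (px ∷ u) =
  VecAll.toList⁻ (All.map (λ x≢y → x≢y ∘ cong toℕ) (All.map⁻ px)) VecPairs.∷ Unique-letters⁻ v u

letters-injective : ∀ {n k} {v w : Vec (Fin n) k} → letters v ≡ letters w → v ≡ w
letters-injective {v = []}    {[]}    eq = refl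
letters-injective {v = x ∷ v} {y ∷ w} eq =
  cong₂ _∷_ (Fin.toℕ-injective (∷-injectiveˡ eq)) (letters-injective (∷-injectiveʳ eq))

letters-length : ∀ {n k} (v : Vec (Fin n) k) → length (letters v) ≡ k
letters-length []      = refl
letters-length (x ∷ v) = cong suc (letters-length v)

letters-surjective : ∀ {n k} ws → length ws ≡ k → All (_< n) ws → ∃[ v ] letters {n} {k} v ≡ ws
letters-surjective []       refl _            = [] , refl
letters-surjective (w ∷ ws) refl (w<n ∷ ws<n) with letters-surjective ws refl ws<n
... | v , eq = fromℕ< w<n ∷ v , cong₂ _∷_ (Fin.toℕ-fromℕ< w<n) eq

-- Both lists are free of repetitions, so having the same elements suffices.
S⟨132⟩↭words : ∀ n → map (word 0) (trees n) ↭ map letters (S⟨ τ₁₃₂ ⟩ n)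
S⟨132⟩↭words n = ∼bag⇒↭ (unique∧set⇒bag
  (Unique.map⁺ (word-injective 0 _ _) (trees-unique n))
  (Unique.map⁺ letters-injective (Unique.filter⁺ (avoids? τ₁₃₂) (permutations-unique n)))
  (mk⇔ to from))
  where
  to : ∀ {ws} → ws ∈ map (word 0) (trees n) → ws ∈ map letters (S⟨ τ₁₃₂ ⟩ n)
  to ws∈ with ∈-map⁻ (word 0) ws∈
  ... | t , t∈ , refl with size-∈-trees {n} t∈
  ...   | refl with letters-surjective (word 0 t) (word-length 0 t) (All.map proj₂ (word-within 0 t))
  ...     | σ , eq = subst (_∈ map letters (S⟨ τ₁₃₂ ⟩ n)) eq (∈-map⁺ letters
    (∈-filter⁺ (avoids? τ₁₃₂)
      (∈-permutations (Unique-letters⁻ σ (subst Unique (sym eq) (shape⇒Unique (word-shape 0 t)))))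
      (Av⇒Avoids σ (subst Av (sym eq) (shape⇒Av (word-shape 0 t))))))
  from : ∀ {ws} → ws ∈ map letters (S⟨ τ₁₃₂ ⟩ n) → ws ∈ map (word 0) (trees n)
  from ws∈ with ∈-map⁻ letters ws∈
  ... | σ , σ∈ , refl with ∈-filter⁻ (avoids? τ₁₃₂) {xs = permutations n} σ∈
  ...   | σ∈′ , avoids with ∈-filter⁻ unique? {xs = vectors _ n} σ∈′
  ...     | _ , u with ∃shape n (letters σ) (≤-reflexive (letters-length σ)) (Avoids⇒Av σ avoids) (Unique-letters⁺ u)
  ...       | t , shape = subst (_∈ map (word 0) (trees n))
    (sym (shape-word shape (subst (λ k → All (Within 0 k) (letters σ)) (sym size≡n)
      (All-letters⁺ σ (λ i → z≤n , Fin.toℕ<n (lookup σ i))))))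
    (∈-map⁺ (word 0) (subst (λ k → t ∈ trees k) size≡n (∈-trees t)))
    where
    size≡n : size t ≡ n
    size≡n = trans (sym (shape-length shape)) (letters-length σ)

-- Reordering the trees aligns them with the permutations entry by entry, so that sums can be
-- compared termwise.
S⟨132⟩-trees : ∀ n → ∃[ ts ] (map letters (S⟨ τ₁₃₂ ⟩ n) ≡ map (word 0) ts × trees n ↭ ts)
S⟨132⟩-trees n = ↭-map-inv (word 0) (S⟨132⟩↭words n)

-- Bounds for the sum over all permutations

sum-longest-bounds : ∀ {n} σs ts → map (letters {n}) σs ≡ map (word 0) ts →
  sum (map cuts ts) * 3 ≤ sum (map (longest UUD) σs) + length ts * 3 ×
  sum (map (longest UUD) σs) ≤ sum (map cuts ts) * 3 + length ts * 2
sum-longest-bounds []       []       eq = z≤n , z≤n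
sum-longest-bounds (σ ∷ σs) (t ∷ ts) eq with ∷-injective eq
... | eq₁ , eq₂ with sum-longest-bounds σs ts eq₂
...   | lower , upper =
  subst₂ _≤_ (sym (*-distribʳ-+ 3 (cuts t) _)) (arith₁ (longest UUD σ) 3 _ (length ts * 3))
    (+-mono-≤ (≤-trans (reach-≥ t) (longest-≥ σ shape)) lower) ,
  subst (longest UUD σ + sum (map (longest UUD) σs) ≤_) (arith₂ (cuts t) (sum (map cuts ts)) (length ts))
    (+-mono-≤ (≤-trans (longest-≤ σ shape) (reach-≤ t)) upper)
  where
  shape : Shape t (letters σ)
  shape = subst (Shape t) (sym eq₁) (word-shape 0 t)
  arith₁ : ∀ a b c d → (a + b) + (c + d) ≡ (a + c) + (b + d)
  arith₁ = solve-∀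
  arith₂ : ∀ c k l → (c * 3 + 2) + (k * 3 + l * 2) ≡ (c + k) * 3 + (2 + l * 2)
  arith₂ = solve-∀

total-𝟙 : ∀ n → total 𝟙 n ≡ length (trees n)
total-𝟙 n = count (trees n)
  where
  count : ∀ ts → sum (map 𝟙 ts) ≡ length ts
  count []       = refl
  count (t ∷ ts) = cong suc (count ts)

total-leaves : ∀ n → total leaves n ≡ suc n * length (trees n)
total-leaves n = go (trees n) size-∈-trees
  where
  go : ∀ ts → (∀ {t} → t ∈ ts → size t ≡ n) → sum (map leaves ts) ≡ suc n * length ts
  go []       p = sym (*-zeroʳ (suc n))
  go (t ∷ ts) p = trans (cong₂ _+_ (trans (leaves≡1+size t) (cong suc (p (here refl)))) (go ts (p ∘ there)))
    (sym (*-suc (suc n) (length ts)))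

indicator-≤ : ∀ {φ} → (∀ t → φ t ≤ 1) → ∀ n → total φ n ≤ length (trees n)
indicator-≤ {φ} p n = subst (total φ n ≤_) (total-𝟙 n) (total-≤ {φ} {𝟙} p n)

cuts-upper : ∀ n → 7 * total cuts n ≤ (n + 2) * length (trees n)
cuts-upper n = begin
  7 * total cuts n
    ≤⟨ m≤m+n _ _ ⟩
  7 * total cuts n + (2 * total isOne n + (4 * total isTwo n + total isLeaf n))
    ≡⟨ arith₁ (total cuts n) (total isOne n) (total isTwo n) (total isLeaf n) ⟩
  7 * total cuts n + 2 * total isOne n + 4 * total isTwo n + total isLeaf n
    ≡⟨ cuts-identity n ⟩
  total leaves n + total (𝟙 ⊗ isTwo) n
    ≤⟨ +-mono-≤ (≤-reflexive (total-leaves n)) (indicator-≤ bound n) ⟩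
  suc n * length (trees n) + length (trees n)
    ≡⟨ arith₂ n (length (trees n)) ⟩
  (n + 2) * length (trees n)
    ∎
  where
  open ≤-Reasoning
  bound : ∀ t → (𝟙 ⊗ isTwo) t ≤ 1
  bound leaf = z≤n
  bound (node g h) with state h
  ... | none  = z≤n
  ... | spent = z≤n
  ... | one   = z≤n
  ... | two   = ≤-refl
  arith₁ : ∀ k a b d → 7 * k + (2 * a + (4 * b + d)) ≡ 7 * k + 2 * a + 4 * b + d
  arith₁ = solve-∀
  arith₂ : ∀ n l → (1 + n) * l + l ≡ (n + 2) * l
  arith₂ = solve-∀

-- The error 7 is 2 + 4 + 1, the coefficients in `cuts-identity` of three counts that are each at
-- most the number of trees.
cuts-lower : ∀ n → n * length (trees n) ≤ 7 * total cuts n + 7 * length (trees n)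
cuts-lower n = begin
  n * L                                                                     ≤⟨ m≤n+m (n * L) L ⟩
  suc n * L                                                                 ≡⟨ total-leaves n ⟨
  total leaves n                                                            ≤⟨ m≤m+n _ _ ⟩
  total leaves n + total (𝟙 ⊗ isTwo) n                                      ≡⟨ cuts-identity n ⟨
  7 * total cuts n + 2 * total isOne n + 4 * total isTwo n + total isLeaf n
    ≤⟨ +-mono-≤ (+-mono-≤ (+-monoʳ-≤ (7 * total cuts n) (*-monoʳ-≤ 2 (indicator-≤ one-bound n)))
                          (*-monoʳ-≤ 4 (indicator-≤ two-bound n))) (indicator-≤ leaf-bound n) ⟩
  7 * total cuts n + 2 * L + 4 * L + L                                      ≡⟨ arith (total cuts n) L ⟩
  7 * total cuts n + 7 * L                                                  ∎
  where
  open ≤-Reasoning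
  L : ℕ
  L = length (trees n)
  one-bound : ∀ t → isOne t ≤ 1
  one-bound t with state t
  ... | none  = z≤n
  ... | spent = z≤n
  ... | one   = ≤-refl
  ... | two   = z≤n
  two-bound : ∀ t → isTwo t ≤ 1
  two-bound t with state t
  ... | none  = z≤n
  ... | spent = z≤n
  ... | one   = z≤n
  ... | two   = ≤-refl
  leaf-bound : ∀ t → isLeaf t ≤ 1
  leaf-bound leaf       = ≤-refl
  leaf-bound (node g h) = z≤n
  arith : ∀ k l → 7 * k + 2 * l + 4 * l + l ≡ 7 * k + 7 * l
  arith = solve-∀

-- The errors come out as `20 * l` above and `42 * l` below; both are rounded up to `50 * l`, so
-- that one constant serves both sides.
three-cuts-close : ∀ {n k l t} → 7 * k ≤ (n + 2) * l → n * l ≤ 7 * k + 7 * l →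
  k * 3 ≤ t + l * 3 → t ≤ k * 3 + l * 2 → 7 * t ≤ (3 * n + 50) * l × 3 * n * l ≤ 7 * t + 50 * l
three-cuts-close {n} {k} {l} {t} cuts-upper cuts-lower lower upper = (begin
  7 * t                               ≤⟨ *-monoʳ-≤ 7 upper ⟩
  7 * (k * 3 + l * 2)                 ≡⟨ arith₁ k l ⟩
  3 * (7 * k) + 14 * l                ≤⟨ +-monoˡ-≤ (14 * l) (*-monoʳ-≤ 3 cuts-upper) ⟩
  3 * ((n + 2) * l) + 14 * l          ≤⟨ m≤m+n _ (30 * l) ⟩
  3 * ((n + 2) * l) + 14 * l + 30 * l ≡⟨ arith₂ n l ⟩
  (3 * n + 50) * l                    ∎) , (begin
  3 * n * l                           ≡⟨ *-assoc 3 n l ⟩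
  3 * (n * l)                         ≤⟨ *-monoʳ-≤ 3 cuts-lower ⟩
  3 * (7 * k + 7 * l)                 ≡⟨ arith₃ k l ⟩
  7 * (k * 3) + 21 * l                ≤⟨ +-monoˡ-≤ (21 * l) (*-monoʳ-≤ 7 lower) ⟩
  7 * (t + l * 3) + 21 * l            ≤⟨ m≤m+n _ (8 * l) ⟩
  7 * (t + l * 3) + 21 * l + 8 * l    ≡⟨ arith₄ t l ⟩
  7 * t + 50 * l                      ∎)
  where
  open ≤-Reasoning
  arith₁ : ∀ k l → 7 * (k * 3 + l * 2) ≡ 3 * (7 * k) + 14 * l
  arith₁ = solve-∀
  arith₂ : ∀ n l → 3 * ((n + 2) * l) + 14 * l + 30 * l ≡ (3 * n + 50) * l
  arith₂ = solve-∀
  arith₃ : ∀ k l → 3 * (7 * k + 7 * l) ≡ 7 * (k * 3) + 21 * l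
  arith₃ = solve-∀
  arith₄ : ∀ t l → 7 * (t + l * 3) + 21 * l + 8 * l ≡ 7 * t + 50 * l
  arith₄ = solve-∀

longest-total-close : ∀ n (σs : List (Word n)) → ∃[ ts ] (map letters σs ≡ map (word 0) ts × trees n ↭ ts) →
  7 * sum (map (longest UUD) σs) ≤ (3 * n + 50) * length σs ×
  3 * n * length σs ≤ 7 * sum (map (longest UUD) σs) + 50 * length σs
longest-total-close n σs (ts , eq , trees↭ts) with sum-longest-bounds σs ts eq
... | lower , upper = three-cuts-close {n} {total cuts n} {length σs} {sum (map (longest UUD) σs)}
  (subst (λ l → 7 * total cuts n ≤ (n + 2) * l) trees≡ (cuts-upper n))
  (subst (λ l → n * l ≤ 7 * total cuts n + 7 * l) trees≡ (cuts-lower n))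
  (subst₂ (λ k l → k * 3 ≤ sum (map (longest UUD) σs) + l * 3) cuts≡ ts≡ lower)
  (subst₂ (λ k l → sum (map (longest UUD) σs) ≤ k * 3 + l * 2) cuts≡ ts≡ upper)
  where
  cuts≡ : sum (map cuts ts) ≡ total cuts n
  cuts≡ = sym (sum-↭ (↭-map⁺ cuts trees↭ts))
  ts≡ : length ts ≡ length σs
  ts≡ = trans (sym (length-map (word 0) ts)) (trans (cong length (sym eq)) (length-map letters σs))
  trees≡ : length (trees n) ≡ length σs
  trees≡ = trans (↭-length trees↭ts) ts≡

-- The ratio of the expectation to 3n/7

open import Algebra.Properties.Group ℚ.+-0-group using (⁻¹-involutive)
open import Data.Integer.Base using (+_; +[1+_])

-- Since |x/y - 1| = |x - y| / y, two one-sided bounds with a common error `c` suffice.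
∣÷-1∣< : ∀ (x y c ε : ℚ) .{{_ : ℚ.Positive y}} .{{_ : ℚ.NonZero y}} →
        x ℚ.≤ y ℚ.+ c → y ℚ.≤ x ℚ.+ c → c ℚ.< ε ℚ.* y →
        ℚ.∣ x ℚ.÷ y ℚ.- 1ℚ ∣ ℚ.< ε
∣÷-1∣< x y c ε x≤ y≤ c< = begin-strict
  ℚ.∣ x ℚ.÷ y ℚ.- 1ℚ ∣                ≡⟨ cong (λ z → ℚ.∣ x ℚ.÷ y ℚ.- z ∣) (ℚ.*-inverseʳ y) ⟨
  ℚ.∣ x ℚ.÷ y ℚ.- y ℚ.÷ y ∣           ≡⟨ cong (λ z → ℚ.∣ x ℚ.÷ y ℚ.+ z ∣) (ℚ.neg-distribˡ-* y (ℚ.1/ y)) ⟩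
  ℚ.∣ x ℚ.÷ y ℚ.+ (ℚ.- y) ℚ.÷ y ∣     ≡⟨ cong ℚ.∣_∣ (ℚ.*-distribʳ-+ (ℚ.1/ y) x (ℚ.- y)) ⟨
  ℚ.∣ (x ℚ.- y) ℚ.÷ y ∣               ≡⟨ ℚ.∣p*q∣≡∣p∣*∣q∣ (x ℚ.- y) (ℚ.1/ y) ⟩
  ℚ.∣ x ℚ.- y ∣ ℚ.* ℚ.∣ ℚ.1/ y ∣      ≡⟨ cong (ℚ.∣ x ℚ.- y ∣ ℚ.*_) (ℚ.0≤p⇒∣p∣≡p (ℚ.<⇒≤ (ℚ.positive⁻¹ (ℚ.1/ y)))) ⟩
  ℚ.∣ x ℚ.- y ∣ ℚ.÷ y                 <⟨ ℚ.*-monoˡ-<-pos (ℚ.1/ y) (ℚ.≤-<-trans ∣x-y∣≤c c<) ⟩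
  (ε ℚ.* y) ℚ.÷ y                     ≡⟨ ℚ.*-assoc ε y (ℚ.1/ y) ⟩
  ε ℚ.* (y ℚ.÷ y)                     ≡⟨ cong (ε ℚ.*_) (ℚ.*-inverseʳ y) ⟩
  ε ℚ.* 1ℚ                            ≡⟨ ℚ.*-identityʳ ε ⟩
  ε                                   ∎
  where
  open ℚ.≤-Reasoning
  instance
    1/y>0 : ℚ.Positive (ℚ.1/ y)
    1/y>0 = ℚ.1/pos⇒pos y
  difference : ∀ {p q} → p ℚ.≤ q ℚ.+ c → p ℚ.- q ℚ.≤ c
  difference {p} {q} p≤ = ℚ.≤-trans (ℚ.+-monoˡ-≤ (ℚ.- q) p≤) (ℚ.≤-reflexive
    (trans (cong (ℚ._- q) (ℚ.+-comm q c)) (trans (ℚ.+-assoc c q (ℚ.- q))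
      (trans (cong (c ℚ.+_) (ℚ.+-inverseʳ q)) (ℚ.+-identityʳ c)))))
  ∣x-y∣≤c : ℚ.∣ x ℚ.- y ∣ ℚ.≤ c
  ∣x-y∣≤c with ℚ.∣p∣≡p∨∣p∣≡-p (x ℚ.- y)
  ... | inj₁ eq = ℚ.≤-trans (ℚ.≤-reflexive eq) (difference x≤)
  ... | inj₂ eq = ℚ.≤-trans (ℚ.≤-reflexive (trans eq
    (trans (ℚ.neg-distrib-+ x (ℚ.- y)) (trans (ℚ.+-comm (ℚ.- x) (ℚ.- (ℚ.- y))) (cong (ℚ._- x) (⁻¹-involutive y))))))
    (difference y≤)

toℚᵘ-/ : ∀ a b → toℚᵘ (+ a / suc b) ℚᵘ.≃ mkℚᵘ (+ a) b
toℚᵘ-/ a b = ℚ.toℚᵘ-fromℚᵘ (mkℚᵘ (+ a) b)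

3n/7 : ℕ → ℚ
3n/7 n = (+ 3 / 7) ℚ.* (+ n / 1)

c₀ : ℚ
c₀ = + 50 / 7

toℚᵘ-3n/7 : ∀ n → toℚᵘ (3n/7 n) ℚᵘ.≃ mkℚᵘ (+ (3 * n)) 6
toℚᵘ-3n/7 n = ℚᵘ.≃-trans (ℚ.toℚᵘ-homo-* (+ 3 / 7) (+ n / 1)) (ℚᵘ.≃-trans
  (ℚᵘ.*-congˡ {mkℚᵘ (+ 3) 6} (toℚᵘ-/ n 0)) (ℚᵘ.*≡* (cong (ℤ._* + 7) (sym (ℤ.pos-* 3 n)))))

-- Unnormalised fractions compare by cross multiplication. The sum on the right then has denominator
-- 7 · 7, hence the hypothesis is multiplied by 7.
mean≤ : ∀ T L n .{{_ : NonZero L}} → 7 * T ≤ (3 * n + 50) * L → + T / L ℚ.≤ 3n/7 n ℚ.+ c₀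
mean≤ T (suc l) n le = ℚ.toℚᵘ-cancel-≤ (begin
  toℚᵘ (+ T / suc l)                  ≃⟨ toℚᵘ-/ T l ⟩
  mkℚᵘ (+ T) l                        ≤⟨ *≤* (subst₂ ℤ._≤_ (ℤ.pos-* T 49) lemma (ℤ.+≤+ nat)) ⟩
  mkℚᵘ (+ (3 * n)) 6 ℚᵘ.+ toℚᵘ c₀     ≃⟨ ℚᵘ.+-congˡ (toℚᵘ c₀) (toℚᵘ-3n/7 n) ⟨
  toℚᵘ (3n/7 n) ℚᵘ.+ toℚᵘ c₀          ≃⟨ ℚ.toℚᵘ-homo-+ (3n/7 n) c₀ ⟨
  toℚᵘ (3n/7 n ℚ.+ c₀)                ∎)
  where
  open ℚᵘ.≤-Reasoning
  nat : T * 49 ≤ (3 * n * 7 + 350) * suc l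
  nat = subst₂ _≤_ (arith₁ T) (arith₂ n (suc l)) (*-monoʳ-≤ 7 le)
    where
    arith₁ : ∀ t → 7 * (7 * t) ≡ t * 49
    arith₁ = solve-∀
    arith₂ : ∀ n l → 7 * ((3 * n + 50) * l) ≡ (3 * n * 7 + 350) * l
    arith₂ = solve-∀
  lemma : + ((3 * n * 7 + 350) * suc l) ≡ (+ (3 * n) ℤ.* + 7 ℤ.+ + 50 ℤ.* + 7) ℤ.* + suc l
  lemma = trans (ℤ.pos-* (3 * n * 7 + 350) (suc l))
    (cong (λ z → (z ℤ.+ + 350) ℤ.* + suc l) (ℤ.pos-* (3 * n) 7))

mean≥ : ∀ T L n .{{_ : NonZero L}} → 3 * n * L ≤ 7 * T + 50 * L → 3n/7 n ℚ.≤ + T / L ℚ.+ c₀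
mean≥ T (suc l) n le = ℚ.toℚᵘ-cancel-≤ (begin
  toℚᵘ (3n/7 n)                       ≃⟨ toℚᵘ-3n/7 n ⟩
  mkℚᵘ (+ (3 * n)) 6                  ≤⟨ *≤* (subst₂ ℤ._≤_ (ℤ.pos-* (3 * n) (suc l * 7)) lemma (ℤ.+≤+ nat)) ⟩
  mkℚᵘ (+ T) l ℚᵘ.+ toℚᵘ c₀           ≃⟨ ℚᵘ.+-congˡ (toℚᵘ c₀) (toℚᵘ-/ T l) ⟨
  toℚᵘ (+ T / suc l) ℚᵘ.+ toℚᵘ c₀     ≃⟨ ℚ.toℚᵘ-homo-+ (+ T / suc l) c₀ ⟨
  toℚᵘ (+ T / suc l ℚ.+ c₀)           ∎)
  where
  open ℚᵘ.≤-Reasoning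
  nat : 3 * n * (suc l * 7) ≤ (T * 7 + 50 * suc l) * 7
  nat = subst₂ _≤_ (arith₁ n (suc l)) (arith₂ T (suc l)) (*-monoˡ-≤ 7 le)
    where
    arith₁ : ∀ n l → 3 * n * l * 7 ≡ 3 * n * (l * 7)
    arith₁ = solve-∀
    arith₂ : ∀ t l → (7 * t + 50 * l) * 7 ≡ (t * 7 + 50 * l) * 7
    arith₂ = solve-∀
  lemma : + ((T * 7 + 50 * suc l) * 7) ≡ (+ T ℤ.* + 7 ℤ.+ + 50 ℤ.* + suc l) ℤ.* + 7
  lemma = trans (ℤ.pos-* (T * 7 + 50 * suc l) 7)
    (cong₂ (λ y z → (y ℤ.+ z) ℤ.* + 7) (ℤ.pos-* T 7) (ℤ.pos-* 50 (suc l)))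

-- A positive `ε` is at least 1 over its denominator, and 17 is the least integer with 3 · 17 > 50.
c₀<ε*3n/7 : ∀ ε n → .{{_ : ℚ.Positive ε}} → 17 * ℚ.↧ₙ ε ≤ n → c₀ ℚ.< ε ℚ.* 3n/7 n
c₀<ε*3n/7 ε@(mkℚ +[1+ p ] d _) n le = ℚ.toℚᵘ-cancel-< (begin-strict
  mkℚᵘ (+ 50) 6                       <⟨ *<* (subst₂ ℤ._<_ (ℤ.pos-* 50 (suc d * 7)) lemma (ℤ.+<+ nat)) ⟩
  mkℚᵘ +[1+ p ] d ℚᵘ.* mkℚᵘ (+ (3 * n)) 6 ≃⟨ ℚᵘ.*-congˡ {toℚᵘ ε} (toℚᵘ-3n/7 n) ⟨
  toℚᵘ ε ℚᵘ.* toℚᵘ (3n/7 n)           ≃⟨ ℚ.toℚᵘ-homo-* ε (3n/7 n) ⟨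
  toℚᵘ (ε ℚ.* 3n/7 n)                 ∎)
  where
  open ℚᵘ.≤-Reasoning
  nat : 50 * (suc d * 7) < suc p * (3 * n) * 7
  nat = ≤-Reasoning.begin-strict
    50 * (suc d * 7)           ≤-Reasoning.<⟨ *-monoˡ-< (suc d * 7) (n<1+n 50) ⟩
    51 * (suc d * 7)           ≤-Reasoning.≡⟨ arith (suc d) ⟩
    3 * (17 * suc d) * 7       ≤-Reasoning.≤⟨ *-monoˡ-≤ 7 (*-monoʳ-≤ 3 le) ⟩
    3 * n * 7                  ≤-Reasoning.≤⟨ *-monoˡ-≤ 7 (m≤m+n (3 * n) (p * (3 * n))) ⟩
    suc p * (3 * n) * 7        ≤-Reasoning.∎
    where
    arith : ∀ d → 51 * (d * 7) ≡ 3 * (17 * d) * 7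
    arith = solve-∀
  lemma : + (suc p * (3 * n) * 7) ≡ +[1+ p ] ℤ.* + (3 * n) ℤ.* + 7
  lemma = trans (ℤ.pos-* (suc p * (3 * n)) 7) (cong (ℤ._* + 7) (ℤ.pos-* (suc p) (3 * n)))

theorem1 : (λ n → E₁₃₂ n (longest UUD)) ∼ (λ n → (+ 3 / 7) ℚ.* (+ n / 1))
theorem1 ε 0<ε = suc (17 * ℚ.↧ₙ ε) , close
  where
  close : ∀ n → suc (17 * ℚ.↧ₙ ε) ≤ n → _
  -- The successor in the threshold lets `n` be matched as `suc m`, which makes the positivity of
  -- `3n/7 n` available.
  close n@(suc m) (s≤s 17/ε≤m) = ℚ.pos⇒nonZero (3n/7 n) ,
    ∣÷-1∣< (E₁₃₂ n (longest UUD)) (3n/7 n) c₀ ε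
      (mean≤ total-longest count n {{S⟨132⟩-nonZero n}} (proj₁ bounds))
      (mean≥ total-longest count n {{S⟨132⟩-nonZero n}} (proj₂ bounds))
      (c₀<ε*3n/7 ε n {{ℚ.positive 0<ε}} (m≤n⇒m≤1+n 17/ε≤m))
    where
    total-longest count : ℕ
    total-longest = sum (map (longest UUD) (S⟨ τ₁₃₂ ⟩ n))
    count = length (S⟨ τ₁₃₂ ⟩ n)
    bounds : 7 * total-longest ≤ (3 * n + 50) * count × 3 * n * count ≤ 7 * total-longest + 50 * count
    bounds = longest-total-close n (S⟨ τ₁₃₂ ⟩ n) (S⟨132⟩-trees n)
    instance
      n/1>0 : ℚ.Positive (+ n / 1)
      n/1>0 = ℚ.normalize-pos n 1
      3n/7>0 : ℚ.Positive (3n/7 n)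
      3n/7>0 = ℚ.pos*pos⇒pos (+ 3 / 7) (+ n / 1)
      3n/7≢0 : ℚ.NonZero (3n/7 n)
      3n/7≢0 = ℚ.pos⇒nonZero (3n/7 n)
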